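{- Let $K$ be a global field, let $V$ be a projective variety over $K$, and let $S$ be a height controlled and uniformly log-discrete set of endomorphisms of $V$ with respect to a divisor class $\eta\in\mathrm{Pic}(V)\otimes\mathbb{R}$. Then the following statements hold. (1) There are a positive constant $b=b(S,\eta)$ and a constant $B_{S,\eta}$ such that $$\#\{Q\in \mathrm{Orb}_{S}(P) : H_\eta(Q)\leq B\}\ll (\log B)^{b}$$ for all $P\in V$ with $H_\eta(P)>B_{S,\eta}$. (2) If the monoid $M_S$ is free (non-abelian), then for all $\epsilon>0$ there are a positive constant $b=b(S,\eta,\epsilon)$ and a constant $B_{S,\eta}$ such that $$(\log B)^{b}\ll\#\{f\in M_S : H_\eta(f(P))\leq B\}\ll (\log B)^{b+\epsilon}$$ for all $P\in V$ with $H_\eta(P)>B_{S,\eta}$. In both statements the implicit constants depend on $P$, $S$, $\eta$ (and on $\epsilon$ in statement (2)).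
   Context: Points of $V$ are points of $V(\overline{K})$. For $\eta\in\mathrm{Pic}(V)\otimes\mathbb{R}$, $h_\eta:V(\overline{K})\to\mathbb{R}$ denotes a fixed choice of (absolute logarithmic) Weil height function associated to $\eta$ (well defined up to $O(1)$), and $H_\eta=\exp\circ h_\eta$. If $\phi$ is an endomorphism of $V$ and $d_\phi\in\mathbb{R}$ satisfies $\phi^*(\eta)=d_\phi\eta$ in $\mathrm{Pic}(V)\otimes\mathbb{R}$, then $C(V,\eta,\phi)$ denotes the minimal constant such that $|h_\eta(\phi(P))-d_\phi h_\eta(P)|\leq C(V,\eta,\phi)$ for all $P\in V$. A (possibly infinite) set $S$ of endomorphisms of $V$ is height controlled with respect to $\eta$ if: (i) for every $\phi\in S$ there is a real number $d_\phi>1$ with $\phi^*(\eta)=d_\phi\eta$; and (ii) $\sup_{\phi\in S}C(V,\eta,\phi)<\infty$. It is height controlled and uniformly log-discrete with respect to $\eta$ if, in addition, there is a constant $\delta>0$ such that $|\log d_\phi-\log d_\psi|>\delta$ for all distinct $\phi,\psi\in S$. $M_S$ is the monoid generated by $S$ under composition (including the identity map), and $\mathrm{Orb}_S(P)=\{f(P): f\in M_S\}$. "$M_S$ is free (non-abelian)" means that $S$ has at least two elements and $M_S$ is a free monoid on the generating set $S$, i.e. $\theta_1\circ\cdots\circ\theta_r=\tau_1\circ\cdots\circ\tau_k$ with $\theta_i,\tau_j\in S$ implies $r=k$ and $\theta_i=\tau_i$ for all $i$. The notation $F(B)\ll G(B)$ means that there are a constant $c>0$ and a $B_0$ such that $F(B)\le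 c\,G(B)$ for all $B\ge B_0$; both $c$ and $B_0$ may depend on the indicated data. -}

module Defs where

open import Level using (0ℓ) renaming (suc to lsuc)
open import Function.Base using (_∘_; id)
open import Function.Bundles using (_⇔_)
open import Data.Nat.Base as ℕ using (ℕ; zero; suc)
open import Data.Nat.Primality using (Prime)
open import Data.Integer.Base as ℤ using (ℤ; +_; -[1+_]; 0ℤ; 1ℤ)
open import Data.Fin.Base using (Fin; toℕ)
open import Data.Product.Base using (Σ; ∃; ∃-syntax; _×_; _,_; proj₁; proj₂; map₁; map₂)
open import Data.Sum.Base using (_⊎_)
open import Data.List.Base using (List; []; _∷_; _++_; [_]; map; foldr; length)
open import Data.List.Relation.Unary.All using (All)
open import Data.List.Relation.Binary.Pointwise using (Pointwise)
open import Data.List.Relation.Unary.Unique.Setoid using (Unique)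
open import Data.Vec.Functional as Vector using (Vector)
open import Data.Unit.Base using (⊤)
open import Relation.Nullary using (¬_)
open import Relation.Unary using (Pred; _∈_; _∩_; Satisfiable; Universal)
open import Relation.Binary.Core using (Rel)
open import Relation.Binary.Bundles using (Setoid; TotalOrder)
open import Relation.Binary.Structures using (IsTotalOrder)
open import Relation.Binary.PropositionalEquality as ≡ using (_≡_; _≢_)
open import Algebra.Bundles using (CommutativeRing; RawRing)
open import Algebra.Morphism.Structures using (module RingMorphisms)
open RingMorphisms using (IsRingHomomorphism)
import Data.List.Membership.Setoid as Membership
import Relation.Binary.Construct.NonStrictToStrict as Strict
import Algebra.Construct.NaturalChoice.Max as Max
import Algebra.Definitions.RawSemiring as RawSemiringDefs
import Relation.Binary.Reasoning.Setoid as ≈-Reasoning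

module _ {a ℓ} (A : Setoid a ℓ) where
  open Setoid A using (Carrier)

  record Enumerates {p} (P : Pred Carrier p) (xs : List Carrier) : Set (a Level.⊔ ℓ Level.⊔ p) where
    field
      unique   : Unique A xs
      complete : ∀ x → P x ⇔ Membership._∈_ A x xs

  HasCardinality : ∀ {p} → Pred Carrier p → ℕ → Set (a Level.⊔ ℓ Level.⊔ p)
  HasCardinality P n = ∃[ xs ] (Enumerates P xs × length xs ≡ n)

-- The inverse is total; the value of 0# ⁻¹ is arbitrary.
record Field : Set₁ where
  infix 9 _⁻¹
  field
    commutativeRing : CommutativeRing 0ℓ 0ℓ
  open CommutativeRing commutativeRing public
  open RawSemiringDefs (RawRing.rawSemiring rawRing) public
    using (_^_; sum) renaming (_×_ to infixr 8 _·_)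
  field
    1≉0      : 1# ≉ 0#
    _⁻¹      : Carrier → Carrier
    ⁻¹-cong  : ∀ {x y} → x ≈ y → x ⁻¹ ≈ y ⁻¹
    inverseʳ : ∀ {x} → x ≉ 0# → x * x ⁻¹ ≈ 1#

  fromℤ : ℤ → Carrier
  fromℤ (+ n)    = n · 1#
  fromℤ -[1+ n ] = - (suc n · 1#)

  evalℤ : ∀ {n} → Vector ℤ n → Carrier → Carrier
  evalℤ p t = sum (λ i → fromℤ (p i) * t ^ toℕ i)

  *-nonzero : ∀ {x y} → x ≉ 0# → y ≉ 0# → x * y ≉ 0#
  *-nonzero {x} {y} x≉0 y≉0 xy≈0 = x≉0 (begin
    x                ≈⟨ *-identityʳ x ⟨
    x * 1#           ≈⟨ *-congˡ (inverseʳ y≉0) ⟨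
    x * (y * y ⁻¹)   ≈⟨ *-assoc x y (y ⁻¹) ⟨
    (x * y) * y ⁻¹   ≈⟨ *-congʳ xy≈0 ⟩
    0# * y ⁻¹        ≈⟨ zeroˡ (y ⁻¹) ⟩
    0#               ∎)
    where open ≈-Reasoning setoid

  inverseˡ : ∀ {x} → x ≉ 0# → x ⁻¹ * x ≈ 1#
  inverseˡ x≉0 = trans (*-comm _ _) (inverseʳ x≉0)

  ⁻¹-nonzero : ∀ {x} → x ≉ 0# → x ⁻¹ ≉ 0#
  ⁻¹-nonzero {x} x≉0 x⁻¹≈0 =
    1≉0 (trans (sym (inverseʳ x≉0)) (trans (*-congˡ x⁻¹≈0) (zeroʳ x)))

  *-swap : ∀ a b c d → (a * b) * (c * d) ≈ (a * c) * (b * d)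
  *-swap a b c d = begin
    (a * b) * (c * d)  ≈⟨ *-assoc a b (c * d) ⟩
    a * (b * (c * d))  ≈⟨ *-congˡ (*-assoc b c d) ⟨
    a * ((b * c) * d)  ≈⟨ *-congˡ (*-congʳ (*-comm b c)) ⟩
    a * ((c * b) * d)  ≈⟨ *-congˡ (*-assoc c b d) ⟩
    a * (c * (b * d))  ≈⟨ *-assoc a c (b * d) ⟨
    (a * c) * (b * d)  ∎
    where open ≈-Reasoning setoid

-- A complete totally ordered field, which determines ℝ up to unique isomorphism.
-- The laws exp-+ and 1+x≤exp determine exp, and exp-log determines log on
-- positive arguments; log x is arbitrary for x ≤ 0.
record RealNumbers : Set₁ where
  infix 4 _≤_ _<_ _>_ _≥_
  field
    realField : Field
  open Field realField public
  field
    _≤_          : Rel Carrier 0ℓ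
    isTotalOrder : IsTotalOrder _≈_ _≤_
    +-monoʳ-≤    : ∀ x {y z} → y ≤ z → x + y ≤ x + z
    *-nonNeg     : ∀ {x y} → 0# ≤ x → 0# ≤ y → 0# ≤ x * y
    supremum     : (A : Pred Carrier 0ℓ) → Satisfiable A →
                   ∃[ u ] (∀ x → A x → x ≤ u) →
                   ∃[ s ] ((∀ x → A x → x ≤ s) × (∀ u → (∀ x → A x → x ≤ u) → s ≤ u))

  _<_ : Rel Carrier 0ℓ
  _<_ = Strict._<_ _≈_ _≤_

  field
    exp      : Carrier → Carrier
    exp-cong : ∀ {x y} → x ≈ y → exp x ≈ exp y
    exp-+    : ∀ x y → exp (x + y) ≈ exp x * exp y
    1+x≤exp  : ∀ x → 1# + x ≤ exp x
    log      : Carrier → Carrier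
    exp-log  : ∀ {x} → 0# < x → exp (log x) ≈ x

  _>_ _≥_ : Rel Carrier 0ℓ
  x > y = y < x
  x ≥ y = y ≤ x

  totalOrder : TotalOrder 0ℓ 0ℓ 0ℓ
  totalOrder = record { isTotalOrder = isTotalOrder }

  open Max totalOrder public using (_⊔_)

  ∣_∣ : Carrier → Carrier
  ∣ x ∣ = x ⊔ (- x)

  infixr 8 _^ʳ_
  -- For positive bases.
  _^ʳ_ : Carrier → Carrier → Carrier
  x ^ʳ b = exp (b * log x)

  fromℕ : ℕ → Carrier
  fromℕ n = n · 1#

  infix 4 _≪_
  _≪_ : (F G : Carrier → Carrier) → Set
  F ≪ G = ∃[ c ] (c > 0# × ∃[ B₀ ] (∀ B → B ≥ B₀ → F B ≤ c * G B))

  ℂ : RawRing 0ℓ 0ℓ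
  ℂ = record
    { Carrier = Carrier × Carrier
    ; _≈_     = λ z w → proj₁ z ≈ proj₁ w × proj₂ z ≈ proj₂ w
    ; _+_     = λ z w → proj₁ z + proj₁ w , proj₂ z + proj₂ w
    ; _*_     = λ z w → proj₁ z * proj₁ w + - (proj₂ z * proj₂ w)
                      , proj₁ z * proj₂ w + proj₂ z * proj₁ w
    ; -_      = λ z → - proj₁ z , - proj₂ z
    ; 0#      = 0# , 0#
    ; 1#      = 1# , 0#
    }

  ∣_∣²-ℂ : Carrier × Carrier → Carrier
  ∣ z ∣²-ℂ = proj₁ z * proj₁ z + proj₂ z * proj₂ z

module _ (F : Field) where
  open Field F

  PrimeField : Pred Carrier 0ℓ
  PrimeField x = ∃[ a ] ∃[ b ] (fromℤ b ≉ 0# × fromℤ b * x ≈ fromℤ a)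

  -- The subfield 𝔽(t), 𝔽 the prime field; integer coefficients represent those in 𝔽.
  RationalFunctionsIn : Carrier → Pred Carrier 0ℓ
  RationalFunctionsIn t x =
    ∃[ m ] Σ (Vector ℤ m) λ p → ∃[ n ] Σ (Vector ℤ n) λ q →
      evalℤ q t ≉ 0# × evalℤ q t * x ≈ evalℤ p t

  Transcendental : Pred Carrier 0ℓ
  Transcendental t =
    ∀ {n} (p : Vector ℤ n) → evalℤ p t ≈ 0# → ∀ i → fromℤ (p i) ≈ 0#

  record HasDegreeOver (B : Pred Carrier 0ℓ) (n : ℕ) : Set where
    field
      basis       : Vector Carrier n
      spanning    : ∀ x → Σ (Vector Carrier n) λ c →
                    (∀ i → c i ∈ B) × x ≈ sum (λ i → c i * basis i)
      independent : (c : Vector Carrier n) → (∀ i → c i ∈ B) →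
                    sum (λ i → c i * basis i) ≈ 0# → ∀ i → c i ≈ 0#

data GlobalField (K : Field) : Set where
  numberField   : (let open Field K) →
                  (∀ n → n · 1# ≈ 0# → n ≡ 0) →
                  ∀ n → HasDegreeOver K (PrimeField K) n → GlobalField K
  functionField : (let open Field K) →
                  ∀ p → Prime p → p · 1# ≈ 0# →
                  ∀ t → Transcendental K t →
                  ∀ n → HasDegreeOver K (RationalFunctionsIn K t) n → GlobalField K

-- The image of ℚ, resp. 𝔽ₚ(t), in an extension i : K → L.
BaseField : ∀ {K} → GlobalField K → (L : Field) →
            (Field.Carrier K → Field.Carrier L) → Pred (Field.Carrier L) 0ℓ
BaseField (numberField _ _ _)           L i = PrimeField L
BaseField (functionField _ _ _ t _ _ _) L i = RationalFunctionsIn L (i t)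

record AlgebraicClosure (K : Field) : Set₁ where
  private module K = Field K
  field
    closure : Field
  open Field closure public
  field
    ι         : K.Carrier → Carrier
    ι-homo    : IsRingHomomorphism K.rawRing rawRing ι
    algebraic : ∀ x → ∃[ n ] Σ (Vector K.Carrier n) λ a →
                x ^ n + sum (λ i → ι (a i) * x ^ toℕ i) ≈ 0#
    closed    : ∀ n (a : Vector Carrier (suc n)) →
                ∃[ x ] (x ^ suc n + sum (λ i → a i * x ^ toℕ i) ≈ 0#)

module _ (L : Field) where
  open Field L

  -- A normalised discrete valuation v : L^× → ℤ, with an arbitrary value at 0,
  -- whose residue field has q elements, represented by the values of residue.
  record FinitePlace : Set where
    field
      v           : Carrier → ℤ
      v-cong      : ∀ {x y} → x ≉ 0# → x ≈ y → v x ≡ v y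
      v-*         : ∀ {x y} → x ≉ 0# → y ≉ 0# → v (x * y) ≡ v x ℤ.+ v y
      v-+         : ∀ {x y} → x ≉ 0# → y ≉ 0# → x + y ≉ 0# →
                    v x ℤ.⊓ v y ℤ.≤ v (x + y)
      uniformizer : ∃[ π ] (π ≉ 0# × v π ≡ 1ℤ)

    Integral : Pred Carrier 0ℓ
    Integral x = x ≈ 0# ⊎ 0ℤ ℤ.≤ v x

    MaximalIdeal : Pred Carrier 0ℓ
    MaximalIdeal x = x ≈ 0# ⊎ 0ℤ ℤ.< v x

    field
      q                  : ℕ
      residue            : Fin q → Carrier
      residue-integral   : ∀ i → Integral (residue i)
      residue-injective  : ∀ i j → MaximalIdeal (residue i - residue j) → i ≡ j
      residue-surjective : ∀ x → Integral x → ∃[ i ] MaximalIdeal (x - residue i)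

    -- m = min { v (y k) : y k ≠ 0 }
    IsMinimum : ∀ {n} → Vector Carrier n → ℤ → Set
    IsMinimum y m = (∀ k → y k ≉ 0# → m ℤ.≤ v (y k)) × ∃[ k ] (y k ≉ 0# × v (y k) ≡ m)

  finitePlaces : Setoid 0ℓ 0ℓ
  finitePlaces = record
    { Carrier       = FinitePlace
    ; _≈_           = λ v w → ∀ x → x ≉ 0# → FinitePlace.v v x ≡ FinitePlace.v w x
    ; isEquivalence = record
      { refl  = λ _ _ → ≡.refl
      ; sym   = λ e x x≉0 → ≡.sym (e x x≉0)
      ; trans = λ e f x x≉0 → ≡.trans (e x x≉0) (f x x≉0)
      }
    }

module _ (R : RealNumbers) (L : Field) where
  private
    module R = RealNumbers R
    module L = Field L

  record ComplexEmbedding : Set where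
    field
      σ    : L.Carrier → R.Carrier × R.Carrier
      homo : IsRingHomomorphism L.rawRing R.ℂ σ

  complexEmbeddings : Setoid 0ℓ 0ℓ
  complexEmbeddings = record
    { Carrier       = ComplexEmbedding
    ; _≈_           = λ s t → ∀ x → RawRing._≈_ R.ℂ (ComplexEmbedding.σ s x) (ComplexEmbedding.σ t x)
    ; isEquivalence = record
      { refl  = λ _ → R.refl , R.refl
      ; sym   = λ e x → R.sym (proj₁ (e x)) , R.sym (proj₂ (e x))
      ; trans = λ e f x → R.trans (proj₁ (e x)) (proj₁ (f x))
                        , R.trans (proj₂ (e x)) (proj₂ (f x))
      }
    }

-- Homogeneous polynomials over K in the variables X₀,…,X_N, by degree,
-- as expressions: distinct terms may denote the same polynomial.
data Form (K : Field) (N : ℕ) : ℕ → Set where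
  con : Field.Carrier K → Form K N 0
  X   : Fin (suc N) → Form K N 1
  _⊕_ : ∀ {d} → Form K N d → Form K N d → Form K N d
  _⊗_ : ∀ {d e} → Form K N d → Form K N e → Form K N (d ℕ.+ e)

record ProjectiveSet (K : Field) : Set where
  field
    N         : ℕ
    equations : List (∃ (Form K N))

ℙ : ∀ {K} → ℕ → ProjectiveSet K
ℙ m = record { N = m ; equations = [] }

module Geometry {K : Field} (K̄ : AlgebraicClosure K) where
  open AlgebraicClosure K̄

  eval : ∀ {N d} → Form K N d → Vector Carrier (suc N) → Carrier
  eval (con c) x = ι c
  eval (X i)   x = x i
  eval (F ⊕ G) x = eval F x + eval G x
  eval (F ⊗ G) x = eval F x * eval G x

  infix 4 _∼_
  _∼_ : ∀ {n} → Rel (Vector Carrier n) 0ℓ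
  x ∼ y = ∃[ c ] (c ≉ 0# × ∀ i → x i ≈ c * y i)

  record Point (V : ProjectiveSet K) : Set where
    open ProjectiveSet V
    field
      coords  : Vector Carrier (suc N)
      nonzero : ∃[ i ] coords i ≉ 0#
      onV     : All (λ F → eval (proj₂ F) coords ≈ 0#) equations
  open Point public

  points : ProjectiveSet K → Setoid 0ℓ 0ℓ
  points V = record
    { Carrier       = Point V
    ; _≈_           = λ P Q → coords P ∼ coords Q
    ; isEquivalence = record
      { refl  = 1# , 1≉0 , λ _ → sym (*-identityˡ _)
      ; sym   = λ (c , c≉0 , e) → c ⁻¹ , ⁻¹-nonzero c≉0 , λ i →
                sym (trans (*-congˡ (e i))
                    (trans (sym (*-assoc _ _ _))
                    (trans (*-congʳ (inverseˡ c≉0)) (*-identityˡ _))))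
      ; trans = λ (c , c≉0 , e) (d , d≉0 , f) → c * d , *-nonzero c≉0 d≉0 , λ i →
                trans (e i) (trans (*-congˡ (f i)) (sym (*-assoc _ _ _)))
      }
    }

  infix 4 _≈ₚ_
  _≈ₚ_ : ∀ {V} → Rel (Point V) 0ℓ
  _≈ₚ_ {V} = Setoid._≈_ (points V)

  module _ (V : ProjectiveSet K) where
    open ProjectiveSet V

    Zeros : List (∃ (Form K N)) → Pred (Point V) 0ℓ
    Zeros Fs P = All (λ F → eval (proj₂ F) (coords P) ≈ 0#) Fs

    record IsVariety : Set where
      field
        nonempty    : Point V
        irreducible : ∀ Fs Gs → (∀ P → P ∈ Zeros Fs ⊎ P ∈ Zeros Gs) →
                      Universal (Zeros Fs) ⊎ Universal (Zeros Gs)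

  module _ {V : ProjectiveSet K} where
    open ProjectiveSet V

    -- Zariski open over K: a union of sets { H ≠ 0 } with H a form over K.
    IsOpen : Pred (Pred (Point V) 0ℓ) 0ℓ
    IsOpen U = ∀ P → P ∈ U → ∃[ d ] Σ (Form K N d) λ H →
      eval H (coords P) ≉ 0# × (∀ Q → eval H (coords Q) ≉ 0# → Q ∈ U)

    -- Near each point of U, f is a quotient G / H of forms over K of equal degree.
    -- Values of f outside U are irrelevant.
    RegularOn : Pred (Point V) 0ℓ → Pred (Point V → Carrier) 0ℓ
    RegularOn U f = ∀ P → P ∈ U → ∃[ d ] Σ (Form K N d) λ G → Σ (Form K N d) λ H →
      eval H (coords P) ≉ 0# ×
      (∀ Q → Q ∈ U → eval H (coords Q) ≉ 0# → f Q * eval H (coords Q) ≈ eval G (coords Q))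

    ∩-open : ∀ {U W} → IsOpen U → IsOpen W → IsOpen (U ∩ W)
    ∩-open oU oW P (u , w) with oU P u | oW P w
    ... | _ , H , H≉0 , inU | _ , H′ , H′≉0 , inW =
      _ , H ⊗ H′ , *-nonzero H≉0 H′≉0 , λ Q n →
        inU Q (λ z → n (trans (*-congʳ z) (zeroˡ _))) ,
        inW Q (λ z → n (trans (*-congˡ z) (zeroʳ _)))

    *-regular : ∀ {U W D f g} → (∀ Q → Q ∈ D → Q ∈ U × Q ∈ W) →
                RegularOn U f → RegularOn W g → RegularOn D (λ P → f P * g P)
    *-regular D⊆ rf rg P p with rf P (proj₁ (D⊆ P p)) | rg P (proj₂ (D⊆ P p))
    ... | _ , G , H , H≉0 , eq | _ , G′ , H′ , H′≉0 , eq′ =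
      _ , G ⊗ G′ , H ⊗ H′ , *-nonzero H≉0 H′≉0 , λ Q r n →
        trans (*-swap _ _ _ _) (*-cong
          (eq  Q (proj₁ (D⊆ Q r)) (λ z → n (trans (*-congʳ z) (zeroˡ _))))
          (eq′ Q (proj₂ (D⊆ Q r)) (λ z → n (trans (*-congˡ z) (zeroʳ _)))))

  -- Morphisms over K: continuous maps along which regular functions pull back
  -- to regular functions.
  record Morphism (V W : ProjectiveSet K) : Set₁ where
    field
      to         : Point V → Point W
      to-cong    : ∀ {P Q} → P ≈ₚ Q → to P ≈ₚ to Q
      continuous : ∀ {U} → IsOpen U → IsOpen (U ∘ to)
      regular    : ∀ {U f} → IsOpen U → RegularOn U f → RegularOn (U ∘ to) (f ∘ to)
  open Morphism public

  Endo : ProjectiveSet K → Set₁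
  Endo V = Morphism V V

  endos : ProjectiveSet K → Setoid (lsuc 0ℓ) 0ℓ
  endos V = record
    { Carrier       = Endo V
    ; _≈_           = λ φ ψ → ∀ P → to φ P ≈ₚ to ψ P
    ; isEquivalence = record
      { refl  = λ {φ} P → S.refl {to φ P}
      ; sym   = λ {φ} {ψ} e P → S.sym {to φ P} {to ψ P} (e P)
      ; trans = λ {φ} {ψ} {χ} e f P → S.trans {to φ P} {to ψ P} {to χ P} (e P) (f P)
      }
    } where module S = Setoid (points V)

  infix 4 _≈ₑ_
  _≈ₑ_ : ∀ {V} → Rel (Endo V) 0ℓ
  _≈ₑ_ {V} = Setoid._≈_ (endos V)

  idₑ : ∀ {V} → Endo V
  idₑ = record { to = id ; to-cong = id ; continuous = id ; regular = λ _ r → r }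

  infixr 9 _∘ₑ_
  _∘ₑ_ : ∀ {V} → Endo V → Endo V → Endo V
  φ ∘ₑ ψ = record
    { to         = to φ ∘ to ψ
    ; to-cong    = to-cong φ ∘ to-cong ψ
    ; continuous = continuous ψ ∘ continuous φ
    ; regular    = λ o r → regular ψ (continuous φ o) (regular φ o r)
    }

  compose : ∀ {V} → List (Endo V) → Endo V
  compose = foldr _∘ₑ_ idₑ

  -- A line bundle over K, given by transition functions g i j ∈ 𝒪^×(U i ∩ U j):
  -- a section is a family of sᵢ ∈ 𝒪(U i) with sᵢ = g i j sⱼ.
  record LineBundle (V : ProjectiveSet K) : Set₁ where
    field
      I         : Set
      U         : I → Pred (Point V) 0ℓ
      U-open    : ∀ i → IsOpen (U i)
      U-cover   : ∀ P → ∃[ i ] P ∈ U i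
      g         : I → I → Point V → Carrier
      g-regular : ∀ i j → RegularOn (U i ∩ U j) (g i j)
      g-refl    : ∀ i P → P ∈ U i → g i i P ≈ 1#
      g-cocycle : ∀ i j k P → P ∈ U i → P ∈ U j → P ∈ U k → g i j P * g j k P ≈ g i k P

  module _ {V : ProjectiveSet K} where
    -- Isomorphism: h i j is the transition function from the j-th chart of M
    -- to the i-th chart of L.
    infix 4 _≅_
    record _≅_ (L M : LineBundle V) : Set₁ where
      private
        module L = LineBundle L
        module M = LineBundle M
      field
        h         : L.I → M.I → Point V → Carrier
        h-regular : ∀ i j → RegularOn (L.U i ∩ M.U j) (h i j)
        h-unit    : ∀ i j P → P ∈ L.U i → P ∈ M.U j → h i j P ≉ 0#
        h-left    : ∀ i i′ j P → P ∈ L.U i → P ∈ L.U i′ → P ∈ M.U j →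
                    L.g i i′ P * h i′ j P ≈ h i j P
        h-right   : ∀ i j j′ P → P ∈ L.U i → P ∈ M.U j → P ∈ M.U j′ →
                    h i j P * M.g j j′ P ≈ h i j′ P

    infixl 7 _⊠_
    _⊠_ : LineBundle V → LineBundle V → LineBundle V
    L ⊠ M = record
      { I         = L.I × M.I
      ; U         = λ (i , j) → L.U i ∩ M.U j
      ; U-open    = λ (i , j) → ∩-open (L.U-open i) (M.U-open j)
      ; U-cover   = λ P → (proj₁ (L.U-cover P) , proj₁ (M.U-cover P))
                        , (proj₂ (L.U-cover P) , proj₂ (M.U-cover P))
      ; g         = λ (i , j) (i′ , j′) P → L.g i i′ P * M.g j j′ P
      ; g-regular = λ (i , j) (i′ , j′) → *-regular
                      (λ _ ((a , b) , (a′ , b′)) → (a , a′) , (b , b′))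
                      (L.g-regular i i′) (M.g-regular j j′)
      ; g-refl    = λ (i , j) P (a , b) →
                      trans (*-cong (L.g-refl i P a) (M.g-refl j P b)) (*-identityˡ 1#)
      ; g-cocycle = λ (i , j) (i′ , j′) (i″ , j″) P (a , b) (a′ , b′) (a″ , b″) →
                      trans (*-swap _ _ _ _)
                        (*-cong (L.g-cocycle i i′ i″ P a a′ a″) (M.g-cocycle j j′ j″ P b b′ b″))
      }
      where
        module L = LineBundle L
        module M = LineBundle M

  infixr 8 _^*_
  _^*_ : ∀ {V W} → Morphism V W → LineBundle W → LineBundle V
  φ ^* L = record
    { I         = L.I
    ; U         = λ i → L.U i ∘ to φ
    ; U-open    = λ i → continuous φ (L.U-open i)
    ; U-cover   = λ P → L.U-cover (to φ P)
    ; g         = λ i j → L.g i j ∘ to φ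
    ; g-regular = λ i j → regular φ (∩-open (L.U-open i) (L.U-open j)) (L.g-regular i j)
    ; g-refl    = λ i P → L.g-refl i (to φ P)
    ; g-cocycle = λ i j k P → L.g-cocycle i j k (to φ P)
    }
    where module L = LineBundle L

  -- On U i = { Xᵢ ≠ 0 } the section X_k of 𝒪(1) is X_k / Xᵢ, so g i j = Xⱼ / Xᵢ.
  𝒪[1] : ∀ m → LineBundle (ℙ m)
  𝒪[1] m = record
    { I         = Fin (suc m)
    ; U         = λ i P → coords P i ≉ 0#
    ; U-open    = λ i P p → 1 , X i , p , λ _ q → q
    ; U-cover   = nonzero
    ; g         = λ i j P → coords P j * coords P i ⁻¹
    ; g-regular = λ i j P (p , _) → 1 , X j , X i , p , λ Q _ n →
                    trans (*-assoc _ _ _) (trans (*-congˡ (inverseˡ n)) (*-identityʳ _))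
    ; g-refl    = λ i P p → inverseʳ p
    ; g-cocycle = λ i j k P p q r →
                    trans (*-comm _ _)
                    (trans (*-assoc _ _ _)
                    (*-congˡ (trans (sym (*-assoc _ _ _))
                             (trans (*-congʳ (inverseˡ q)) (*-identityˡ _)))))
    }

module Heights (R : RealNumbers) {K : Field} (gf : GlobalField K) (K̄ : AlgebraicClosure K) where
  open RealNumbers R renaming (Carrier to ℝ)
  open Geometry K̄
  private
    module K  = Field K
    module K̄ = AlgebraicClosure K̄

  sumList : List ℝ → ℝ
  sumList = foldr _+_ 0#

  -- h is the absolute logarithmic height of [x₀ : … : x_N].  With homogeneous
  -- coordinates y in a finite extension L of K in K̄, and k = ℚ or 𝔽ₚ(t),
  --   [L : k] h = Σ_σ log maxᵢ |σ yᵢ| + Σ_v (- minᵢ v(yᵢ)) log q_v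
  -- over all ring homomorphisms σ : L → ℂ (so that a pair of conjugate embeddings
  -- accounts for the local degree 2; there are none in positive characteristic)
  -- and all finite places v.  The list of places has to contain every v with
  -- minᵢ v(yᵢ) ≠ 0, and log |z| is ½ log |z|².
  record IsHeight {N} (x : Vector K̄.Carrier (suc N)) (h : ℝ) : Set₁ where
    field
      L         : Field
    private module L = Field L
    field
      i         : K.Carrier → L.Carrier
      i-homo    : IsRingHomomorphism K.rawRing L.rawRing i
      j         : L.Carrier → K̄.Carrier
      j-homo    : IsRingHomomorphism L.rawRing K̄.rawRing j
      j∘i       : ∀ a → j (i a) K̄.≈ K̄.ι a
      degree    : ℕ
      hasDegree : HasDegreeOver L (BaseField gf L i) degree
      y         : Vector L.Carrier (suc N)
      x∼y       : x ∼ j ∘ y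

      embeddings        : List (ComplexEmbedding R L)
      embeddings-all    : Enumerates (complexEmbeddings R L) (λ _ → ⊤) embeddings
      places            : List (FinitePlace L × ℤ)
      places-min        : All (λ (w , m) → FinitePlace.IsMinimum w y m) places
      places-unique     : Unique (finitePlaces L) (map proj₁ places)
      places-complete   : ∀ w m → FinitePlace.IsMinimum w y m → m ≢ 0ℤ →
                          Membership._∈_ (finitePlaces L) w (map proj₁ places)

    archimedean : ComplexEmbedding R L → ℝ
    archimedean s =
      (2 · 1#) ⁻¹ * log (Vector.foldr _⊔_ 0# (λ k → ∣ ComplexEmbedding.σ s (y k) ∣²-ℂ))

    nonarchimedean : FinitePlace L × ℤ → ℝ
    nonarchimedean (w , m) = fromℤ (ℤ.- m) * log (fromℕ (FinitePlace.q w))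

    field
      formula : degree · h ≈ sumList (map archimedean embeddings)
                             + sumList (map nonarchimedean places)

  module _ {V : ProjectiveSet K} where

    infix 4 _≈η_
    data _≈η_ : Rel (List (ℝ × LineBundle V)) (lsuc 0ℓ) where
      ≈η-refl  : ∀ {η} → η ≈η η
      ≈η-sym   : ∀ {η θ} → η ≈η θ → θ ≈η η
      ≈η-trans : ∀ {η θ ζ} → η ≈η θ → θ ≈η ζ → η ≈η ζ
      ++-cong  : ∀ {η η′ θ θ′} → η ≈η η′ → θ ≈η θ′ → η ++ θ ≈η η′ ++ θ′
      ++-comm  : ∀ η θ → η ++ θ ≈η θ ++ η
      ⊗-cong   : ∀ {a b L M} → a ≈ b → L ≅ M → [ a , L ] ≈η [ b , M ]
      ⊗-zeroˡ  : ∀ L → [ 0# , L ] ≈η []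
      ⊗-distʳ  : ∀ a b L → [ a + b , L ] ≈η (a , L) ∷ [ b , L ]
      ⊗-distˡ  : ∀ a L M → [ a , L ⊠ M ] ≈η (a , L) ∷ [ a , M ]

  -- Elements of Pic(V) ⊗ ℝ: formal sums of pure tensors a ⊗ L, compared by _≈η_.
  Picℝ : ProjectiveSet K → Set₁
  Picℝ V = List (ℝ × LineBundle V)

  pullback : ∀ {V} → Endo V → Picℝ V → Picℝ V
  pullback φ = map (map₂ (φ ^*_))

  infixr 7 _•_
  _•_ : ∀ {V} → ℝ → Picℝ V → Picℝ V
  r • η = map (map₁ (r *_)) η

  -- A term a · φ*𝒪(1), with the function P ↦ h(φ(P)).
  record HeightTerm (V : ProjectiveSet K) : Set₁ where
    field
      coefficient : ℝ
      m           : ℕ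
      φ           : Morphism V (ℙ m)
      height      : Point V → ℝ
      isHeight    : ∀ P → IsHeight (coords (to φ P)) (height P)

    class : ℝ × LineBundle V
    class = coefficient , φ ^* 𝒪[1] m

    contribution : Point V → ℝ
    contribution P = coefficient * height P

  -- h is a Weil height for η = Σ aᵢ φᵢ*𝒪(1) if h = Σ aᵢ h∘φᵢ + O(1).
  record IsWeilHeight {V : ProjectiveSet K} (η : Picℝ V) (h : Point V → ℝ) : Set₁ where
    field
      h-cong  : ∀ {P Q} → P ≈ₚ Q → h P ≈ h Q
      terms   : List (HeightTerm V)
      η≈terms : η ≈η map HeightTerm.class terms
      bounded : ∃[ C ] ∀ P →
                ∣ h P - sumList (map (λ t → HeightTerm.contribution t P) terms) ∣ ≤ C

  module _ {V : ProjectiveSet K} (η : Picℝ V) (h : Point V → ℝ) where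

    -- c = C(V, η, φ), for the multiplier d of φ.
    IsMinimalConstant : Endo V → ℝ → ℝ → Set
    IsMinimalConstant φ d c = Bound c × (∀ c′ → Bound c′ → c ≤ c′)
      where
        Bound : ℝ → Set
        Bound c = ∀ P → ∣ h (to φ P) - d * h P ∣ ≤ c

    record HeightControlled (S : Pred (Endo V) 0ℓ) : Set₁ where
      field
        d        : ∀ φ → φ ∈ S → ℝ
        d-cong   : ∀ {φ ψ} (s : φ ∈ S) (t : ψ ∈ S) → φ ≈ₑ ψ → d φ s ≈ d ψ t
        d>1      : ∀ φ s → d φ s > 1#
        eigen    : ∀ φ s → pullback φ η ≈η d φ s • η
        sup<∞    : ∃[ M ] ∀ φ s → ∃[ c ] (IsMinimalConstant φ (d φ s) c × c ≤ M)

    record UniformlyLogDiscrete (S : Pred (Endo V) 0ℓ) : Set₁ where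
      field
        heightControlled : HeightControlled S
      open HeightControlled heightControlled public
      field
        logDiscrete : ∃[ δ ] (δ > 0# × ∀ φ ψ s t → ¬ φ ≈ₑ ψ →
                      ∣ log (d φ s) - log (d ψ t) ∣ > δ)

  module _ {V : ProjectiveSet K} (S : Pred (Endo V) 0ℓ) where

    GeneratedMonoid : Pred (Endo V) (lsuc 0ℓ)
    GeneratedMonoid f = ∃[ θs ] (All S θs × f ≈ₑ compose θs)

    Orbit : Point V → Pred (Point V) (lsuc 0ℓ)
    Orbit P Q = ∃[ f ] (f ∈ GeneratedMonoid × Q ≈ₚ to f P)

    record IsFreeNonabelian : Set₁ where
      field
        twoElements : ∃[ φ ] ∃[ ψ ] (φ ∈ S × ψ ∈ S × ¬ φ ≈ₑ ψ)
        free        : ∀ θs τs → All S θs → All S τs → compose θs ≈ₑ compose τs →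
                      Pointwise _≈ₑ_ θs τs

module Submission where

open import Level using (0ℓ; Lift; lift; lower) renaming (suc to lsuc)
open import Axiom.ExcludedMiddle using (ExcludedMiddle)
open import Function.Base using (_∘_; const)
open import Function.Bundles using (mk⇔; module Equivalence)
open import Data.Nat.Base as ℕ using (ℕ; zero; suc)
import Data.Nat.Properties as ℕ
import Data.Nat.ListAction as ℕ
open import Data.Integer.Base as ℤ using (ℤ; +_; -[1+_])
import Data.Integer.Properties as ℤ
open import Data.Product.Base using (Σ; ∃-syntax; _×_; _,_; proj₁; proj₂)
open import Data.Sum.Base using (_⊎_; inj₁; inj₂; [_,_]′)
open import Data.Maybe.Base using (Maybe; just; nothing)
open import Data.Maybe.Relation.Unary.Any as Maybe using (just)
open import Data.List.Base
  using (List; []; _∷_; _++_; map; foldr; length; concat; head; cartesianProductWith; deduplicate; downFrom)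
open import Data.List.Properties using (length-++; length-map)
open import Data.List.Relation.Unary.All as All using (All; []; _∷_)
import Data.List.Relation.Unary.All.Properties as All
open import Data.List.Relation.Unary.AllPairs using ([]; _∷_)
open import Data.List.Relation.Unary.Any using (here; there; _─_)
open import Data.List.Relation.Unary.Any.Properties using (++⁺ˡ; ++⁺ʳ)
open import Data.List.Relation.Unary.Unique.Setoid using (Unique)
import Data.List.Relation.Unary.Unique.Setoid.Properties as Unique
import Data.List.Relation.Unary.Unique.DecSetoid.Properties as DecUnique
import Data.List.Membership.Setoid as Membership
import Data.List.Membership.Setoid.Properties as ∈
open import Data.List.Membership.Propositional.Properties using (∈-downFrom⁺)
open import Data.List.Relation.Binary.Pointwise as Pointwise using (Pointwise; []; _∷_)
open import Relation.Nullary using (¬_; Dec; yes; no; contradiction)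
open import Relation.Nullary.Decidable using (map′)
open import Relation.Unary using (Pred; _∈_)
open import Relation.Binary.Bundles using (Setoid; DecSetoid; TotalOrder)
open import Relation.Binary.Definitions using (_Respects_)
open import Relation.Binary.Structures using (IsTotalOrder)
open import Relation.Binary.PropositionalEquality as ≡ using (_≡_)
import Relation.Binary.Construct.On as On
import Relation.Binary.Reasoning.PartialOrder as ≤-Reasoning
import Relation.Binary.Reasoning.Setoid as ≈-Reasoning
open import Algebra.Bundles using (CommutativeRing)
open import Algebra.Solver.Ring.AlmostCommutativeRing
  using (fromCommutativeRing; _-Raw-AlmostCommutative⟶_)
import Algebra.Solver.Ring as RingSolver
import Algebra.Properties.Ring as RingProperties
import Algebra.Properties.Semiring.Mult.TCOptimised as Multiples
import Algebra.Construct.NaturalChoice.Max as Max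
import Algebra.Construct.NaturalChoice.MaxOp as MaxOp
open import Defs

-- If every multiplier d_φ exceeds 1 by a fixed amount, the errors accumulated along a word f
-- sum like a geometric series: for a constant A and h(P) > A,
--   d_f (h(P) - A) ≤ h(f(P)) - A   and   h(f(P)) + A ≤ d_f (h(P) + A).
-- Hence H(f(P)) ≤ B is, up to a bounded shift, the condition that the weight log d_f of f is at
-- most log log B, and the problem is to count words by weight.  If Σ_φ d_φ^{-b} < 1, then
-- Σ_f d_f^{-b} over all words is finite and at most O((log B)^b) words qualify; b exists since
-- the log d_φ are separated.  If Σ_φ d_φ^{-b} ≥ 1 already over finitely many φ, then splitting
-- words at their first letter produces at least a constant times (log B)^b of them.  Two
-- elements of S give such a b > 0, and moving upwards in small steps gives one for which
-- b + ε falls under the first case.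

-- Logical and algebraic preliminaries.

lower-em : ∀ {a b} → ExcludedMiddle (a Level.⊔ b) → ExcludedMiddle a
lower-em {b = b} em {P} = map′ lower lift (em {Lift b P})

-- Integer coefficients let the solver cancel x - x, which coefficients in R cannot.
module IntegerSolver {c ℓ} (R : CommutativeRing c ℓ) where
  open CommutativeRing R
  open RingProperties ring
  open Multiples semiring renaming (_×_ to _×′_)
  open ≈-Reasoning setoid

  ⟦_⟧ℤ : ℤ → Carrier
  ⟦ + n ⟧ℤ      = n ×′ 1#
  ⟦ -[1+ n ] ⟧ℤ = - (suc n ×′ 1#)

  ⟦⟧-⊖ : ∀ m n → ⟦ m ℤ.⊖ n ⟧ℤ ≈ m ×′ 1# - n ×′ 1#
  ⟦⟧-⊖ m       zero    = begin
    ⟦ m ℤ.⊖ 0 ⟧ℤ       ≡⟨⟩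
    m ×′ 1#            ≈⟨ +-identityʳ _ ⟨
    m ×′ 1# + 0#       ≈⟨ +-congˡ -0#≈0# ⟨
    m ×′ 1# - 0#       ∎
  ⟦⟧-⊖ zero    (suc n) = sym (+-identityˡ _)
  ⟦⟧-⊖ (suc m) (suc n) = begin
    ⟦ suc m ℤ.⊖ suc n ⟧ℤ                   ≡⟨ ≡.cong ⟦_⟧ℤ (ℤ.[1+m]⊖[1+n]≡m⊖n m n) ⟩
    ⟦ m ℤ.⊖ n ⟧ℤ                           ≈⟨ ⟦⟧-⊖ m n ⟩
    m ×′ 1# - n ×′ 1#                      ≈⟨ +-congʳ (xyx⁻¹≈y 1# _) ⟨
    1# + m ×′ 1# - 1# - n ×′ 1#            ≈⟨ +-assoc _ _ _ ⟩
    1# + m ×′ 1# + (- 1# - n ×′ 1#)        ≈⟨ +-congˡ (-‿+-comm 1# _) ⟩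
    1# + m ×′ 1# - (1# + n ×′ 1#)          ≈⟨ +-cong (1+× m 1#) (-‿cong (1+× n 1#)) ⟨
    suc m ×′ 1# - suc n ×′ 1#              ∎

  ⟦⟧-neg : ∀ i → ⟦ ℤ.- i ⟧ℤ ≈ - ⟦ i ⟧ℤ
  ⟦⟧-neg (+ zero)   = sym -0#≈0#
  ⟦⟧-neg (+ suc n)  = refl
  ⟦⟧-neg -[1+ n ]   = sym (-‿involutive _)

  ⟦⟧-+ : ∀ i j → ⟦ i ℤ.+ j ⟧ℤ ≈ ⟦ i ⟧ℤ + ⟦ j ⟧ℤ
  ⟦⟧-+ (+ m)    (+ n)    = ×-homo-+ 1# m n
  ⟦⟧-+ (+ m)    -[1+ n ] = ⟦⟧-⊖ m (suc n)
  ⟦⟧-+ -[1+ m ] (+ n)    = trans (⟦⟧-⊖ n (suc m)) (+-comm _ _)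
  ⟦⟧-+ -[1+ m ] -[1+ n ] = begin
    - (suc (suc (m ℕ.+ n)) ×′ 1#)        ≡⟨ ≡.cong (λ k → - (k ×′ 1#)) (≡.cong suc (ℕ.+-suc m n)) ⟨
    - ((suc m ℕ.+ suc n) ×′ 1#)          ≈⟨ -‿cong (×-homo-+ 1# (suc m) (suc n)) ⟩
    - (suc m ×′ 1# + suc n ×′ 1#)        ≈⟨ -‿+-comm _ _ ⟨
    - (suc m ×′ 1#) - suc n ×′ 1#        ∎

  ⟦⟧-*-pos : ∀ n j → ⟦ + n ℤ.* j ⟧ℤ ≈ (n ×′ 1#) * ⟦ j ⟧ℤ
  ⟦⟧-*-pos zero    j = begin
    ⟦ + 0 ℤ.* j ⟧ℤ       ≡⟨ ≡.cong ⟦_⟧ℤ (ℤ.*-zeroˡ j) ⟩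
    0#                   ≈⟨ zeroˡ _ ⟨
    0# * ⟦ j ⟧ℤ          ∎
  ⟦⟧-*-pos (suc n) j = begin
    ⟦ + suc n ℤ.* j ⟧ℤ                 ≡⟨ ≡.cong ⟦_⟧ℤ (ℤ.suc-* (+ n) j) ⟩
    ⟦ j ℤ.+ + n ℤ.* j ⟧ℤ               ≈⟨ ⟦⟧-+ j (+ n ℤ.* j) ⟩
    ⟦ j ⟧ℤ + ⟦ + n ℤ.* j ⟧ℤ            ≈⟨ +-cong (sym (*-identityˡ _)) (⟦⟧-*-pos n j) ⟩
    1# * ⟦ j ⟧ℤ + (n ×′ 1#) * ⟦ j ⟧ℤ   ≈⟨ distribʳ _ _ _ ⟨
    (1# + n ×′ 1#) * ⟦ j ⟧ℤ            ≈⟨ *-congʳ (1+× n 1#) ⟨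
    (suc n ×′ 1#) * ⟦ j ⟧ℤ             ∎

  ⟦⟧-* : ∀ i j → ⟦ i ℤ.* j ⟧ℤ ≈ ⟦ i ⟧ℤ * ⟦ j ⟧ℤ
  ⟦⟧-* (+ n)    j = ⟦⟧-*-pos n j
  ⟦⟧-* -[1+ n ] j = begin
    ⟦ -[1+ n ] ℤ.* j ⟧ℤ             ≡⟨ ≡.cong ⟦_⟧ℤ (ℤ.neg-distribˡ-* (+ suc n) j) ⟨
    ⟦ ℤ.- (+ suc n ℤ.* j) ⟧ℤ        ≈⟨ ⟦⟧-neg (+ suc n ℤ.* j) ⟩
    - ⟦ + suc n ℤ.* j ⟧ℤ            ≈⟨ -‿cong (⟦⟧-*-pos (suc n) j) ⟩
    - ((suc n ×′ 1#) * ⟦ j ⟧ℤ)      ≈⟨ -‿distribˡ-* _ _ ⟩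
    - (suc n ×′ 1#) * ⟦ j ⟧ℤ        ∎

  morphism : ℤ.+-*-rawRing -Raw-AlmostCommutative⟶ fromCommutativeRing R
  morphism = record
    { ⟦_⟧    = ⟦_⟧ℤ
    ; +-homo = ⟦⟧-+
    ; *-homo = ⟦⟧-*
    ; -‿homo = ⟦⟧-neg
    ; 0-homo = refl
    ; 1-homo = refl
    }

  -- Only equality is ever certified, since distinct integers may have the same image in `R`, for
  -- instance in positive characteristic.
  ≟-weakly : ∀ i j → Maybe (⟦ i ⟧ℤ ≈ ⟦ j ⟧ℤ)
  ≟-weakly i j with i ℤ.≟ j
  ... | yes i≡j = just (reflexive (≡.cong ⟦_⟧ℤ i≡j))
  ... | no  _   = nothing

  open RingSolver ℤ.+-*-rawRing (fromCommutativeRing R) morphism ≟-weakly public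
    using (Polynomial; solve; _:=_; con; _:+_; _:*_; _:-_; :-_)

  :0 :1 : ∀ {n} → Polynomial n
  :0 = con (+ 0)
  :1 = con (+ 1)

-- Order, exponential, logarithm and integer part in a complete ordered field.

module RealAnalysis (em : ExcludedMiddle 0ℓ) (R : RealNumbers) where
  open RealNumbers R
  open IsTotalOrder isTotalOrder public
    using (≤-respʳ-≈)
    renaming
    ( refl to ≤-refl; reflexive to ≤-reflexive; trans to ≤-trans
    ; antisym to ≤-antisym; total to ≤-total )
  open IntegerSolver commutativeRing public using (solve; _:=_; :0; :1; _:+_; _:*_; _:-_; :-_)
  open MaxOp (Max.maxOperator totalOrder) using (x≤x⊔y; x≤y⊔x; ⊔-sel)
  module ≤R = ≤-Reasoning (TotalOrder.poset totalOrder)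
  open ≤R

  <⇒≤ : ∀ {x y} → x < y → x ≤ y
  <⇒≤ = proj₁

  <⇒≱ : ∀ {x y} → x < y → ¬ (y ≤ x)
  <⇒≱ (x≤y , x≉y) y≤x = x≉y (≤-antisym x≤y y≤x)

  ≰⇒> : ∀ {x y} → ¬ (x ≤ y) → y < x
  ≰⇒> {x} {y} x≰y with ≤-total x y
  ... | inj₁ x≤y = contradiction x≤y x≰y
  ... | inj₂ y≤x = y≤x , λ y≈x → x≰y (≤-reflexive (sym y≈x))

  ≤-<-connex : ∀ x y → x ≤ y ⊎ y < x
  ≤-<-connex x y with em {x ≤ y}
  ... | yes x≤y = inj₁ x≤y
  ... | no  x≰y = inj₂ (≰⇒> x≰y)

  +-mono-≤ : ∀ {x y u v} → x ≤ y → u ≤ v → x + u ≤ y + v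
  +-mono-≤ {x} {y} {u} {v} x≤y u≤v = begin
    x + u  ≤⟨ +-monoʳ-≤ x u≤v ⟩
    x + v  ≈⟨ +-comm x v ⟩
    v + x  ≤⟨ +-monoʳ-≤ v x≤y ⟩
    v + y  ≈⟨ +-comm v y ⟩
    y + v  ∎

  x≤y⇒0≤y-x : ∀ {x y} → x ≤ y → 0# ≤ y - x
  x≤y⇒0≤y-x {x} {y} x≤y = begin
    0#       ≈⟨ -‿inverseʳ x ⟨
    x - x    ≤⟨ +-mono-≤ x≤y ≤-refl ⟩
    y - x    ∎

  -- Inequalities are proved by exhibiting y - x as a combination of nonnegative terms.
  by-difference : ∀ {x y z} → y - x ≈ z → 0# ≤ z → x ≤ y
  by-difference {x} {y} {z} y-x≈z 0≤z = begin
    x            ≈⟨ +-identityʳ x ⟨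
    x + 0#       ≤⟨ +-monoʳ-≤ x 0≤z ⟩
    x + z        ≈⟨ +-congˡ y-x≈z ⟨
    x + (y - x)  ≈⟨ solve 2 (λ x y → x :+ (y :- x) := y) refl x y ⟩
    y            ∎

  +-nonNeg : ∀ {x y} → 0# ≤ x → 0# ≤ y → 0# ≤ x + y
  +-nonNeg {x} {y} 0≤x 0≤y = begin
    0#       ≈⟨ +-identityʳ 0# ⟨
    0# + 0#  ≤⟨ +-mono-≤ 0≤x 0≤y ⟩
    x + y    ∎

  neg-antitone : ∀ {x y} → x ≤ y → - y ≤ - x
  neg-antitone {x} {y} x≤y = by-difference
    (solve 2 (λ x y → :- x :- :- y := y :- x) refl x y) (x≤y⇒0≤y-x x≤y)

  *-monoʳ-≤ : ∀ {c x y} → 0# ≤ c → x ≤ y → c * x ≤ c * y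
  *-monoʳ-≤ {c} {x} {y} 0≤c x≤y = by-difference
    (solve 3 (λ c x y → c :* y :- c :* x := c :* (y :- x)) refl c x y)
    (*-nonNeg 0≤c (x≤y⇒0≤y-x x≤y))

  *-monoˡ-≤ : ∀ {c x y} → 0# ≤ c → x ≤ y → x * c ≤ y * c
  *-monoˡ-≤ {c} {x} {y} 0≤c x≤y = by-difference
    (solve 3 (λ c x y → y :* c :- x :* c := c :* (y :- x)) refl c x y)
    (*-nonNeg 0≤c (x≤y⇒0≤y-x x≤y))

  *-mono-≤ : ∀ {x y u v} → 0# ≤ x → 0# ≤ v → x ≤ y → u ≤ v → x * u ≤ y * v
  *-mono-≤ 0≤x 0≤v x≤y u≤v = ≤-trans (*-monoʳ-≤ 0≤x u≤v) (*-monoˡ-≤ 0≤v x≤y)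

  x<y⇒0<y-x : ∀ {x y} → x < y → 0# < y - x
  x<y⇒0<y-x {x} {y} (x≤y , x≉y) = x≤y⇒0≤y-x x≤y , λ 0≈y-x → x≉y (begin-equality
    x            ≈⟨ +-identityʳ x ⟨
    x + 0#       ≈⟨ +-congˡ 0≈y-x ⟩
    x + (y - x)  ≈⟨ solve 2 (λ x y → x :+ (y :- x) := y) refl x y ⟩
    y            ∎)

  +-monoʳ-< : ∀ x {y z} → y < z → x + y < x + z
  +-monoʳ-< x {y} {z} y<z = ≰⇒> λ x+z≤x+y → <⇒≱ y<z (by-difference
    (solve 3 (λ x y z → y :- z := x :+ y :- (x :+ z)) refl x y z) (x≤y⇒0≤y-x x+z≤x+y))

  *-pos : ∀ {x y} → 0# < x → 0# < y → 0# < x * y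
  *-pos (0≤x , 0≉x) (0≤y , 0≉y) =
    *-nonNeg 0≤x 0≤y , λ 0≈xy → *-nonzero (0≉x ∘ sym) (0≉y ∘ sym) (sym 0≈xy)

  0≤1 : 0# ≤ 1#
  0≤1 with ≤-total 0# 1#
  ... | inj₁ 0≤1 = 0≤1
  ... | inj₂ 1≤0 = ≤-respʳ-≈ (solve 0 (:- :1 :* :- :1 := :1) refl) (*-nonNeg 0≤-1 0≤-1)
    where
    0≤-1 : 0# ≤ - 1#
    0≤-1 = ≤-trans (x≤y⇒0≤y-x 1≤0) (≤-reflexive (+-identityˡ _))

  0<1 : 0# < 1#
  0<1 = 0≤1 , λ 0≈1 → 1≉0 (sym 0≈1)

  x<1+x : ∀ x → x < 1# + x
  x<1+x x = by-difference (solve 1 (λ x → :1 :+ x :- x := :1) refl x) 0≤1 , λ x≈1+x →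
    1≉0 (begin-equality
      1#            ≈⟨ solve 1 (λ x → :1 := :1 :+ x :- x) refl x ⟩
      1# + x - x    ≈⟨ +-congʳ x≈1+x ⟨
      x - x         ≈⟨ -‿inverseʳ x ⟩
      0#            ∎)

  ⁻¹-pos : ∀ {x} → 0# < x → 0# < x ⁻¹
  ⁻¹-pos {x} 0<x@(0≤x , 0≉x) = ≰⇒> λ x⁻¹≤0 → <⇒≱ 0<1 (begin
    1#                 ≈⟨ inverseʳ (0≉x ∘ sym) ⟨
    x * x ⁻¹           ≤⟨ *-monoʳ-≤ 0≤x x⁻¹≤0 ⟩
    x * 0#             ≈⟨ zeroʳ x ⟩
    0#                 ∎)

  *-inverseʳ : ∀ {x} → 0# < x → x * x ⁻¹ ≈ 1#
  *-inverseʳ (_ , 0≉x) = inverseʳ (0≉x ∘ sym)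

  positive-below : ∀ {x} → 0# < x → ∃[ y ] (0# < y × y < x)
  positive-below {x} 0<x = y , 0<y , (begin-strict
    y                     ≈⟨ +-identityʳ y ⟨
    y + 0#                <⟨ +-monoʳ-< y 0<y ⟩
    y + y                 ≈⟨ solve 2 (λ x h → x :* h :+ x :* h := x :* ((:1 :+ :1) :* h)) refl x ((1# + 1#) ⁻¹) ⟩
    x * ((1# + 1#) * (1# + 1#) ⁻¹)     ≈⟨ *-congˡ (*-inverseʳ 0<2) ⟩
    x * 1#                ≈⟨ *-identityʳ x ⟩
    x                     ∎)
    where
    0<2 : 0# < 1# + 1#
    0<2 = begin-strict 0# <⟨ 0<1 ⟩ 1# <⟨ x<1+x 1# ⟩ 1# + 1# ∎
    y = x * (1# + 1#) ⁻¹
    0<y : 0# < y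
    0<y = *-pos 0<x (⁻¹-pos 0<2)

  *-cancelˡ-≤ : ∀ {c x y} → 0# < c → c * x ≤ c * y → x ≤ y
  *-cancelˡ-≤ {c} {x} {y} 0<c cx≤cy = begin
    x                  ≈⟨ expand x ⟩
    c ⁻¹ * (c * x)     ≤⟨ *-monoʳ-≤ (<⇒≤ (⁻¹-pos 0<c)) cx≤cy ⟩
    c ⁻¹ * (c * y)     ≈⟨ expand y ⟨
    y                  ∎
    where
    expand : ∀ z → z ≈ c ⁻¹ * (c * z)
    expand z = begin-equality
      z               ≈⟨ *-identityˡ z ⟨
      1# * z          ≈⟨ *-congʳ (*-inverseʳ 0<c) ⟨
      c * c ⁻¹ * z    ≈⟨ solve 3 (λ c d z → c :* d :* z := d :* (c :* z)) refl c (c ⁻¹) z ⟩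
      c ⁻¹ * (c * z)  ∎

  x≤∣x∣ : ∀ x → x ≤ ∣ x ∣
  x≤∣x∣ x = x≤x⊔y x (- x)

  -x≤∣x∣ : ∀ x → - x ≤ ∣ x ∣
  -x≤∣x∣ x = x≤y⊔x x (- x)

  ∣x∣-sel : ∀ x → ∣ x ∣ ≈ x ⊎ ∣ x ∣ ≈ - x
  ∣x∣-sel x = ⊔-sel x (- x)

  0≤∣x∣ : ∀ x → 0# ≤ ∣ x ∣
  0≤∣x∣ x with ≤-total 0# x
  ... | inj₁ 0≤x = ≤-trans 0≤x (x≤∣x∣ x)
  ... | inj₂ x≤0 = begin
    0#       ≈⟨ solve 0 (:0 := :- :0) refl ⟩
    - 0#     ≤⟨ neg-antitone x≤0 ⟩
    - x      ≤⟨ -x≤∣x∣ x ⟩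
    ∣ x ∣    ∎

  -- By `exp-+` the value is idempotent, and it is nonzero because `1+x≤exp` bounds it below by 1;
  -- so it can be cancelled.
  exp-0 : exp 0# ≈ 1#
  exp-0 = begin-equality
    exp 0#                            ≈⟨ *-identityʳ _ ⟨
    exp 0# * 1#                       ≈⟨ *-congˡ (inverseʳ exp0≉0) ⟨
    exp 0# * (exp 0# * exp 0# ⁻¹)     ≈⟨ *-assoc _ _ _ ⟨
    exp 0# * exp 0# * exp 0# ⁻¹       ≈⟨ *-congʳ (exp-+ 0# 0#) ⟨
    exp (0# + 0#) * exp 0# ⁻¹         ≈⟨ *-congʳ (exp-cong (+-identityʳ 0#)) ⟩
    exp 0# * exp 0# ⁻¹                ≈⟨ inverseʳ exp0≉0 ⟩
    1#                                ∎
    where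
    exp0≉0 : exp 0# ≉ 0#
    exp0≉0 exp0≈0 = <⇒≱ 0<1 (begin
      1#       ≈⟨ +-identityʳ 1# ⟨
      1# + 0#  ≤⟨ 1+x≤exp 0# ⟩
      exp 0#   ≈⟨ exp0≈0 ⟩
      0#       ∎)

  exp-inverse : ∀ x → exp x * exp (- x) ≈ 1#
  exp-inverse x = begin-equality
    exp x * exp (- x)  ≈⟨ exp-+ x (- x) ⟨
    exp (x - x)        ≈⟨ exp-cong (-‿inverseʳ x) ⟩
    exp 0#             ≈⟨ exp-0 ⟩
    1#                 ∎

  1≤exp : ∀ {x} → 0# ≤ x → 1# ≤ exp x
  1≤exp {x} 0≤x = begin
    1#       ≈⟨ +-identityʳ 1# ⟨
    1# + 0#  ≤⟨ +-monoʳ-≤ 1# 0≤x ⟩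
    1# + x   ≤⟨ 1+x≤exp x ⟩
    exp x    ∎

  -- For `x ≥ 0#` the value is at least 1. For `x ≤ 0#` the reciprocal `exp (- x)` is, and a
  -- nonpositive `exp x` would make their product 1 nonpositive.
  exp-pos : ∀ x → 0# < exp x
  exp-pos x = ≰⇒> λ exp≤0 → case≤ exp≤0 (≤-total 0# x)
    where
    case≤ : exp x ≤ 0# → ¬ (0# ≤ x ⊎ x ≤ 0#)
    case≤ exp≤0 (inj₁ 0≤x) = <⇒≱ 0<1 (≤-trans (1≤exp 0≤x) exp≤0)
    case≤ exp≤0 (inj₂ x≤0) = <⇒≱ 0<1 (begin
      1#                  ≈⟨ exp-inverse x ⟨
      exp x * exp (- x)   ≤⟨ *-monoˡ-≤ (≤-trans 0≤1 (1≤exp 0≤-x)) exp≤0 ⟩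
      0# * exp (- x)      ≈⟨ zeroˡ _ ⟩
      0#                  ∎)
      where
      0≤-x : 0# ≤ - x
      0≤-x = ≤-trans (x≤y⇒0≤y-x x≤0) (≤-reflexive (+-identityˡ _))

  exp-mono-≤ : ∀ {x y} → x ≤ y → exp x ≤ exp y
  exp-mono-≤ {x} {y} x≤y = begin
    exp x                ≈⟨ *-identityʳ _ ⟨
    exp x * 1#           ≤⟨ *-monoʳ-≤ (<⇒≤ (exp-pos x)) (1≤exp (x≤y⇒0≤y-x x≤y)) ⟩
    exp x * exp (y - x)  ≈⟨ exp-+ x (y - x) ⟨
    exp (x + (y - x))    ≈⟨ exp-cong (solve 2 (λ x y → x :+ (y :- x) := y) refl x y) ⟩
    exp y                ∎

  -- The tangent line at 0 suffices: `exp x ≤ exp y` means `exp (x - y) ≤ 1#`, and `1# + (x - y)`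
  -- lies below the left side.
  exp-cancel-≤ : ∀ {x y} → exp x ≤ exp y → x ≤ y
  exp-cancel-≤ {x} {y} expx≤expy = begin
    x                 ≈⟨ solve 2 (λ x y → x := :1 :+ (x :- y) :- :1 :+ y) refl x y ⟩
    1# + (x - y) - 1# + y   ≤⟨ +-mono-≤ (+-mono-≤ exp≤1 ≤-refl) ≤-refl ⟩
    1# - 1# + y             ≈⟨ solve 1 (λ y → :1 :- :1 :+ y := y) refl y ⟩
    y                 ∎
    where
    exp≤1 : 1# + (x - y) ≤ 1#
    exp≤1 = begin
      1# + (x - y)          ≤⟨ 1+x≤exp (x - y) ⟩
      exp (x - y)           ≈⟨ exp-+ x (- y) ⟩
      exp x * exp (- y)     ≤⟨ *-monoˡ-≤ (<⇒≤ (exp-pos _)) expx≤expy ⟩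
      exp y * exp (- y)     ≈⟨ exp-inverse y ⟩
      1#                    ∎

  exp-injective : ∀ {x y} → exp x ≈ exp y → x ≈ y
  exp-injective e = ≤-antisym (exp-cancel-≤ (≤-reflexive e)) (exp-cancel-≤ (≤-reflexive (sym e)))

  exp-cancel-< : ∀ {x y} → exp x < exp y → x < y
  exp-cancel-< expx<expy = ≰⇒> λ y≤x → <⇒≱ expx<expy (exp-mono-≤ y≤x)

  log-cong : ∀ {x y} → 0# < x → x ≈ y → log x ≈ log y
  log-cong {x} {y} 0<x x≈y = exp-injective (begin-equality
    exp (log x)  ≈⟨ exp-log 0<x ⟩
    x            ≈⟨ x≈y ⟩
    y            ≈⟨ exp-log (begin-strict 0# <⟨ 0<x ⟩ x ≈⟨ x≈y ⟩ y ∎) ⟨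
    exp (log y)  ∎)

  ≤-log : ∀ {x y} → exp x ≤ y → x ≤ log y
  ≤-log {x} {y} expx≤y = exp-cancel-≤ (begin
    exp x        ≤⟨ expx≤y ⟩
    y            ≈⟨ exp-log (begin-strict 0# <⟨ exp-pos x ⟩ exp x ≤⟨ expx≤y ⟩ y ∎) ⟨
    exp (log y)  ∎)

  log-pos : ∀ {x} → 1# < x → 0# < log x
  log-pos {x} 1<x = exp-cancel-< (begin-strict
    exp 0#       ≈⟨ exp-0 ⟩
    1#           <⟨ 1<x ⟩
    x            ≈⟨ exp-log (begin-strict 0# <⟨ 0<1 ⟩ 1# <⟨ 1<x ⟩ x ∎) ⟨
    exp (log x)  ∎)

  fromℕ-nonNeg : ∀ n → 0# ≤ fromℕ n
  fromℕ-nonNeg zero    = ≤-refl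
  fromℕ-nonNeg (suc n) = +-nonNeg 0≤1 (fromℕ-nonNeg n)

  fromℕ-mono-≤ : ∀ {m n} → m ℕ.≤ n → fromℕ m ≤ fromℕ n
  fromℕ-mono-≤ {n = n} ℕ.z≤n = fromℕ-nonNeg n
  fromℕ-mono-≤ (ℕ.s≤s m≤n)   = +-monoʳ-≤ 1# (fromℕ-mono-≤ m≤n)

  fromℕ-cancel-≤ : ∀ {m n} → fromℕ m ≤ fromℕ n → m ℕ.≤ n
  fromℕ-cancel-≤ {m} {n} fm≤fn with m ℕ.≤? n
  ... | yes m≤n = m≤n
  ... | no  m≰n = contradiction (≤-trans (fromℕ-mono-≤ (ℕ.≰⇒> m≰n)) fm≤fn) (<⇒≱ (x<1+x (fromℕ n)))

  fromℕ-+ : ∀ m n → fromℕ (m ℕ.+ n) ≈ fromℕ m + fromℕ n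
  fromℕ-+ zero    n = sym (+-identityˡ _)
  fromℕ-+ (suc m) n = trans (+-congˡ (fromℕ-+ m n)) (sym (+-assoc _ _ _))

  archimedean : ∀ x → ∃[ n ] x ≤ fromℕ n
  archimedean x with em {∃[ n ] x ≤ fromℕ n}
  ... | yes ∃n = ∃n
  ... | no ∄n  = contradiction s≤s-1 (<⇒≱ s-1<s)
    where
    IsNatural : Pred Carrier 0ℓ
    IsNatural y = ∃[ n ] y ≈ fromℕ n

    bounded : ∀ y → IsNatural y → y ≤ x
    bounded y (n , y≈n) = ≤-trans (≤-reflexive y≈n) (<⇒≤ (≰⇒> λ x≤n → ∄n (n , x≤n)))

    sup = supremum IsNatural (0# , 0 , refl) (x , bounded)
    s   = proj₁ sup

    s-1<s : s - 1# < s
    s-1<s = begin-strict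
      s - 1#         <⟨ x<1+x (s - 1#) ⟩
      1# + (s - 1#)  ≈⟨ solve 1 (λ s → :1 :+ (s :- :1) := s) refl s ⟩
      s              ∎

    -- With `n` also `suc n` is a natural number below the supremum, so `s - 1#` is already an upper
    -- bound.
    s≤s-1 : s ≤ s - 1#
    s≤s-1 = proj₂ (proj₂ sup) (s - 1#) λ y (n , y≈n) → begin
      y                      ≈⟨ y≈n ⟩
      fromℕ n                ≈⟨ solve 1 (λ m → m := :1 :+ m :- :1) refl (fromℕ n) ⟩
      fromℕ (suc n) - 1#     ≤⟨ +-mono-≤ (proj₁ (proj₂ sup) _ (suc n , refl)) ≤-refl ⟩
      s - 1#                 ∎

  archimedean-multiple : ∀ x {y} → 0# < y → ∃[ n ] x ≤ fromℕ n * y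
  archimedean-multiple x {y} 0<y with archimedean (x * y ⁻¹)
  ... | n , xy⁻¹≤n = n , (begin
    x                ≈⟨ *-identityʳ x ⟨
    x * 1#           ≈⟨ *-congˡ (*-inverseʳ 0<y) ⟨
    x * (y * y ⁻¹)   ≈⟨ solve 3 (λ x y z → x :* (y :* z) := x :* z :* y) refl x y (y ⁻¹) ⟩
    x * y ⁻¹ * y     ≤⟨ *-monoˡ-≤ (<⇒≤ 0<y) xy⁻¹≤n ⟩
    fromℕ n * y      ∎)

  abstract
    floor : ∀ {x} → 0# ≤ x → ∃[ k ] (fromℕ k ≤ x × x < fromℕ (suc k))
    floor {x} 0≤x with archimedean x
    ... | n , x≤n = below n x≤n
      where
      below : ∀ n → x ≤ fromℕ n → ∃[ k ] (fromℕ k ≤ x × x < fromℕ (suc k))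
      below zero    x≤0 = 0 , 0≤x , (begin-strict x ≤⟨ x≤0 ⟩ 0# <⟨ x<1+x 0# ⟩ 1# + 0# ∎)
      below (suc n) x≤1+n with ≤-<-connex (fromℕ (suc n)) x
      ... | inj₁ 1+n≤x = suc n , 1+n≤x , (begin-strict
        x                     ≤⟨ x≤1+n ⟩
        fromℕ (suc n)         <⟨ x<1+x _ ⟩
        fromℕ (suc (suc n))   ∎)
      ... | inj₂ x<1+n with ≤-<-connex x (fromℕ n)
      ...   | inj₁ x≤n = below n x≤n
      ...   | inj₂ n<x = n , <⇒≤ n<x , x<1+n

-- Deletion from lists, and enumeration of sets of bounded size.

module _ {a ℓ} (A : Setoid a ℓ) where
  open Setoid A using (_≈_; _≉_) renaming (Carrier to C)
  open Membership A using () renaming (_∈_ to _∈ₗ_; _∉_ to _∉ₗ_)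

  -- This is the deletion step of the pigeonhole induction in `∑-⊆`.
  ∈-─ : ∀ {x y ys} (x∈ys : x ∈ₗ ys) → y ∈ₗ ys → x ≉ y → y ∈ₗ (ys ─ x∈ys)
  ∈-─ (here x≈z)   (here y≈z)   x≉y = contradiction (Setoid.trans A x≈z (Setoid.sym A y≈z)) x≉y
  ∈-─ (here _)     (there y∈ys) _   = y∈ys
  ∈-─ (there _)    (here y≈z)   _   = here y≈z
  ∈-─ (there x∈ys) (there y∈ys) x≉y = there (∈-─ x∈ys y∈ys x≉y)

  module _ {p} (em : ExcludedMiddle (a Level.⊔ ℓ Level.⊔ p)) {P : Pred C p} (resp : P Respects _≈_) where

    -- Excluded middle either supplies an element missing from the current list or shows that the
    -- list is complete. Since no list without repetitions is longer than `n`, the first case occurs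
    -- at most `n` times.
    bounded⇒enumerable : ∀ n → (∀ xs → Unique A xs → All P xs → length xs ℕ.≤ n) →
                         ∃[ xs ] (Enumerates A P xs × All P xs)
    bounded⇒enumerable n bound = extend n [] [] [] (ℕ.m≤m+n n 0)
      where
      -- k bounds how many elements of P can still be missing from xs.
      extend : ∀ k xs → Unique A xs → All P xs → n ℕ.≤ k ℕ.+ length xs →
               ∃[ ys ] (Enumerates A P ys × All P ys)
      extend k xs xs! pxs n≤ with em {∃[ x ] (P x × x ∉ₗ xs)}
      ... | no  ∄x = xs , record
        { unique   = xs!
        ; complete = λ x → mk⇔ (missing x) (All.lookupₛ A resp pxs)
        } , pxs
        where
        missing : ∀ x → P x → x ∈ₗ xs
        missing x px with lower-em {b = a Level.⊔ ℓ Level.⊔ p} em {x ∈ₗ xs}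
        ... | yes x∈xs = x∈xs
        ... | no  x∉xs = contradiction (x , px , x∉xs) ∄x
      extend zero    xs xs! pxs n≤ | yes (x , px , x∉xs) =
        contradiction (ℕ.≤-trans (bound (x ∷ xs) (∈.∉⇒All[≉] A x∉xs ∷ xs!) (px ∷ pxs)) n≤) (ℕ.n≮n _)
      extend (suc k) xs xs! pxs n≤ | yes (x , px , x∉xs) =
        extend k (x ∷ xs) (∈.∉⇒All[≉] A x∉xs ∷ xs!) (px ∷ pxs)
          (ℕ.≤-trans n≤ (ℕ.≤-reflexive (≡.sym (ℕ.+-suc k (length xs)))))

-- Finite sums of real numbers over lists.

module Sums (em : ExcludedMiddle 0ℓ) (R : RealNumbers) where
  open RealNumbers R renaming (Carrier to ℝ)
  open RealAnalysis em R
  open ≤R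

  ∑ : ∀ {a} {A : Set a} → (A → ℝ) → List A → ℝ
  ∑ f = foldr (λ x s → f x + s) 0#

  module _ {a} {A : Set a} where

    ∑-nonNeg : ∀ {f : A → ℝ} → (∀ x → 0# ≤ f x) → ∀ xs → 0# ≤ ∑ f xs
    ∑-nonNeg 0≤f []       = ≤-refl
    ∑-nonNeg 0≤f (x ∷ xs) = +-nonNeg (0≤f x) (∑-nonNeg 0≤f xs)

    ∑-mono-≤ : ∀ {f g : A → ℝ} {xs} → All (λ x → f x ≤ g x) xs → ∑ f xs ≤ ∑ g xs
    ∑-mono-≤ []           = ≤-refl
    ∑-mono-≤ (fx≤gx ∷ ps) = +-mono-≤ fx≤gx (∑-mono-≤ ps)

    ∑-++ : ∀ (f : A → ℝ) xs ys → ∑ f (xs ++ ys) ≈ ∑ f xs + ∑ f ys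
    ∑-++ f []       ys = sym (+-identityˡ _)
    ∑-++ f (x ∷ xs) ys = trans (+-congˡ (∑-++ f xs ys)) (sym (+-assoc _ _ _))

    ∑-*ˡ : ∀ c (f : A → ℝ) xs → ∑ (λ x → c * f x) xs ≈ c * ∑ f xs
    ∑-*ˡ c f []       = sym (zeroʳ c)
    ∑-*ˡ c f (x ∷ xs) = trans (+-congˡ (∑-*ˡ c f xs)) (sym (distribˡ _ _ _))

    ∑-cong : ∀ {f g : A → ℝ} → (∀ x → f x ≈ g x) → ∀ xs → ∑ f xs ≈ ∑ g xs
    ∑-cong f≈g []       = refl
    ∑-cong f≈g (x ∷ xs) = +-cong (f≈g x) (∑-cong f≈g xs)

    ∑-const : ∀ c (xs : List A) → ∑ (const c) xs ≈ fromℕ (length xs) * c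
    ∑-const c []       = sym (zeroˡ c)
    ∑-const c (x ∷ xs) = begin-equality
      c + ∑ (const c) xs                 ≈⟨ +-congˡ (∑-const c xs) ⟩
      c + fromℕ (length xs) * c
        ≈⟨ solve 2 (λ c n → c :+ n :* c := (:1 :+ n) :* c) refl c (fromℕ (length xs)) ⟩
      (1# + fromℕ (length xs)) * c       ∎

  ∑-map : ∀ {a b} {A : Set a} {B : Set b} (f : B → ℝ) (g : A → B) xs → ∑ f (map g xs) ≡ ∑ (f ∘ g) xs
  ∑-map f g []       = ≡.refl
  ∑-map f g (x ∷ xs) = ≡.cong (_+_ (f (g x))) (∑-map f g xs)

  module _ {a ℓ} (A : Setoid a ℓ) where
    open Setoid A using () renaming (Carrier to C; _≈_ to _≈ₐ_)
    open Membership A using () renaming (_∈_ to _∈ₗ_)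

    module _ {f : C → ℝ} (f-cong : ∀ {x y} → x ≈ₐ y → f x ≈ f y) where

      ∑-─ : ∀ {x ys} (x∈ys : x ∈ₗ ys) → ∑ f ys ≈ f x + ∑ f (ys ─ x∈ys)
      ∑-─ (here x≈y)                   = +-congʳ (sym (f-cong x≈y))
      ∑-─ {x} {ys = y ∷ ys} (there x∈ys) = begin-equality
        f y + ∑ f ys                       ≈⟨ +-congˡ (∑-─ x∈ys) ⟩
        f y + (f x + ∑ f (ys ─ x∈ys))      ≈⟨ solve 3 (λ x y s → y :+ (x :+ s) := x :+ (y :+ s)) refl _ _ _ ⟩
        f x + (f y + ∑ f (ys ─ x∈ys))      ∎

      -- Each entry of `xs` is paired with an entry of `ys`, which is then deleted; uniqueness
      -- guarantees that the later entries of `xs` survive the deletion. What remains of `ys` at the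
      -- end contributes a nonnegative amount.
      ∑-⊆ : (∀ x → 0# ≤ f x) → ∀ {xs ys} → Unique A xs → All (_∈ₗ ys) xs → ∑ f xs ≤ ∑ f ys
      ∑-⊆ 0≤f {[]}     {ys} []         []              = ∑-nonNeg 0≤f ys
      ∑-⊆ 0≤f {x ∷ xs} {ys} (x∉ ∷ xs!) (x∈ys ∷ xs⊆ys) = begin
        f x + ∑ f xs             ≤⟨ +-monoʳ-≤ (f x) (∑-⊆ 0≤f xs!
                                      (All.zipWith (λ (y∈ys , x≉y) → ∈-─ A x∈ys y∈ys x≉y) (xs⊆ys , x∉))) ⟩
        f x + ∑ f (ys ─ x∈ys)    ≈⟨ ∑-─ x∈ys ⟨
        ∑ f ys                   ∎

    length-⊆ : ∀ {xs ys} → Unique A xs → All (_∈ₗ ys) xs → fromℕ (length xs) ≤ fromℕ (length ys)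
    length-⊆ {xs} {ys} xs! xs⊆ys = begin
      fromℕ (length xs)          ≈⟨ *-identityʳ _ ⟨
      fromℕ (length xs) * 1#     ≈⟨ ∑-const 1# xs ⟨
      ∑ (const 1#) xs            ≤⟨ ∑-⊆ (const refl) (const 0≤1) xs! xs⊆ys ⟩
      ∑ (const 1#) ys            ≈⟨ ∑-const 1# ys ⟩
      fromℕ (length ys) * 1#     ≈⟨ *-identityʳ _ ⟩
      fromℕ (length ys)          ∎

  -- Distributivity. With `_∷_` as the operation it factors the total charge of nonempty words into
  -- that of the first letters and that of the tails.
  ∑-cartesianProductWith : ∀ {a b c} {A : Set a} {B : Set b} {C : Set c}
    (_∙_ : A → B → C) (f : A → ℝ) (g : B → ℝ) (h : C → ℝ) → (∀ x y → h (x ∙ y) ≈ f x * g y) →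
    ∀ xs ys → ∑ h (cartesianProductWith _∙_ xs ys) ≈ ∑ f xs * ∑ g ys
  ∑-cartesianProductWith _∙_ f g h mult []       ys = sym (zeroˡ _)
  ∑-cartesianProductWith _∙_ f g h mult (x ∷ xs) ys = begin-equality
    ∑ h (map (x ∙_) ys ++ cartesianProductWith _∙_ xs ys)         ≈⟨ ∑-++ h (map (x ∙_) ys) _ ⟩
    ∑ h (map (x ∙_) ys) + ∑ h (cartesianProductWith _∙_ xs ys)
      ≈⟨ +-cong row (∑-cartesianProductWith _∙_ f g h mult xs ys) ⟩
    f x * ∑ g ys + ∑ f xs * ∑ g ys                                ≈⟨ distribʳ _ _ _ ⟨
    (f x + ∑ f xs) * ∑ g ys                                       ∎
    where
    row : ∑ h (map (x ∙_) ys) ≈ f x * ∑ g ys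
    row = begin-equality
      ∑ h (map (x ∙_) ys)          ≡⟨ ∑-map h (x ∙_) ys ⟩
      ∑ (λ y → h (x ∙ y)) ys       ≈⟨ ∑-cong (mult x) ys ⟩
      ∑ (λ y → f x * g y) ys       ≈⟨ ∑-*ˡ (f x) g ys ⟩
      f x * ∑ g ys                 ∎

-- Counting words by weight over an alphabet with separated weights.

module WordCounting
  {a} (em : ExcludedMiddle a) (R : RealNumbers) (A : Setoid a 0ℓ)
  (w : Setoid.Carrier A → RealNumbers.Carrier R)
  (w-cong : ∀ {x y} → Setoid._≈_ A x y → RealNumbers._≈_ R (w x) (w y))
  (w-pos : ∀ x → RealNumbers._<_ R (RealNumbers.0# R) (w x))
  (δ : RealNumbers.Carrier R) (0<δ : RealNumbers._<_ R (RealNumbers.0# R) δ)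
  (separated : ∀ x y → ¬ Setoid._≈_ A x y →
               RealNumbers._<_ R δ (RealNumbers.∣_∣ R (RealNumbers._-_ R (w x) (w y))))
  where

  open RealNumbers R renaming (Carrier to ℝ)
  open Setoid A using () renaming (Carrier to Letter; _≈_ to _≈ₐ_; _≉_ to _≉ₐ_)

  em₀ : ExcludedMiddle 0ℓ
  em₀ = lower-em {b = a} em

  open RealAnalysis em₀ R
  open Sums em₀ R
  open ≤R
  open Membership A using () renaming (_∈_ to _∈ₐ_)

  Word : Set a
  Word = List Letter

  wordSetoid : Setoid a a
  wordSetoid = Pointwise.setoid A
  open Setoid wordSetoid using () renaming (_≈_ to _≋_)
  open Membership wordSetoid using () renaming (_∈_ to _∈ʷ_)

  weight : Word → ℝ
  weight = ∑ w

  weight-cong : ∀ {u v} → u ≋ v → weight u ≈ weight v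
  weight-cong []           = refl
  weight-cong (x≈y ∷ u≋v)  = +-cong (w-cong x≈y) (weight-cong u≋v)

  weight-nonNeg : ∀ v → 0# ≤ weight v
  weight-nonNeg = ∑-nonNeg (<⇒≤ ∘ w-pos)

  abstract
    -- A letter of weight at most `δ` is a lightest one, because a lighter letter would be lighter
    -- by more than `δ` and so have negative weight. If there is no such letter, `δ` is itself a
    -- lower bound. Keeping `τ ≤ δ` lets `τ` serve as the width of the levels below.
    gap : ∃[ τ ] (0# < τ × τ ≤ δ × (∀ x → τ ≤ w x))
    gap with em {∃[ x ] w x ≤ δ}
    ... | no  ∄x = δ , 0<δ , ≤-refl , λ x → <⇒≤ (≰⇒> λ wx≤δ → ∄x (x , wx≤δ))
    ... | yes (x , wx≤δ) = w x , w-pos x , wx≤δ , λ y → case y (≤-<-connex (w x) (w y))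
      where
      case : ∀ y → w x ≤ w y ⊎ w y < w x → w x ≤ w y
      case y (inj₁ wx≤wy) = wx≤wy
      case y (inj₂ wy<wx) with em₀ {x ≈ₐ y}
      ... | yes x≈y = ≤-reflexive (w-cong x≈y)
      ... | no  x≉y with ∣x∣-sel (w x - w y)
      ...   | inj₁ e = contradiction (begin
        w y          ≈⟨ solve 2 (λ x y → y := x :- (x :- y)) refl (w x) (w y) ⟩
        w x - (w x - w y)     ≤⟨ +-monoʳ-≤ (w x) (neg-antitone (begin
            δ                 ≤⟨ <⇒≤ (separated x y x≉y) ⟩
            ∣ w x - w y ∣     ≈⟨ e ⟩
            w x - w y         ∎)) ⟩
        w x - δ      ≤⟨ +-monoʳ-≤ (w x) (neg-antitone wx≤δ) ⟩
        w x - w x    ≈⟨ -‿inverseʳ (w x) ⟩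
        0#           ∎) (<⇒≱ (w-pos y))
      ...   | inj₂ e = contradiction (begin
        δ                 ≤⟨ <⇒≤ (separated x y x≉y) ⟩
        ∣ w x - w y ∣     ≈⟨ e ⟩
        - (w x - w y)     ≈⟨ solve 2 (λ x y → :- (x :- y) := y :- x) refl (w x) (w y) ⟩
        w y - w x         ≤⟨ +-mono-≤ (<⇒≤ wy<wx) ≤-refl ⟩
        w x - w x         ≈⟨ -‿inverseʳ (w x) ⟩
        0#                ∎) (<⇒≱ 0<δ)

  τ : ℝ
  τ = proj₁ gap

  0<τ : 0# < τ
  0<τ = proj₁ (proj₂ gap)

  τ≤δ : τ ≤ δ
  τ≤δ = proj₁ (proj₂ (proj₂ gap))

  τ≤w : ∀ x → τ ≤ w x
  τ≤w = proj₂ (proj₂ (proj₂ gap))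

  -- Charges of letters and subcritical exponents.

  charge : ℝ → ℝ → ℝ
  charge b t = exp (- (b * t))

  charge-cong : ∀ b {s t} → s ≈ t → charge b s ≈ charge b t
  charge-cong b s≈t = exp-cong (-‿cong (*-congˡ s≈t))

  charge-+ : ∀ b s t → charge b (s + t) ≈ charge b s * charge b t
  charge-+ b s t = trans
    (exp-cong (solve 3 (λ b s t → :- (b :* (s :+ t)) := :- (b :* s) :+ :- (b :* t)) refl b s t))
    (exp-+ _ _)

  charge-nonNeg : ∀ b t → 0# ≤ charge b t
  charge-nonNeg b t = <⇒≤ (exp-pos _)

  charge-antitone : ∀ {b s t} → 0# ≤ b → s ≤ t → charge b t ≤ charge b s
  charge-antitone 0≤b s≤t = exp-mono-≤ (neg-antitone (*-monoʳ-≤ 0≤b s≤t))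

  -- For `w x = log d` the charge is d^(-b). The alphabet may be infinite, so the condition that the
  -- series of charges is at most 1 is put on its finite partial sums.
  Subcritical : ℝ → Set a
  Subcritical b = ∀ F → Unique A F → ∑ (charge b ∘ w) F ≤ 1#

  Supercritical : ℝ → Set a
  Supercritical b = ∃[ F ] (Unique A F × 1# ≤ ∑ (charge b ∘ w) F)

  sub-or-supercritical : ∀ b → Subcritical b ⊎ Supercritical b
  sub-or-supercritical b with em {Supercritical b}
  ... | yes super = inj₂ super
  ... | no ¬super = inj₁ λ F F! → <⇒≤ (≰⇒> λ 1≤∑ → ¬super (F , F! , 1≤∑))

  subcritical-mono : ∀ {b c} → b ≤ c → Subcritical b → Subcritical c
  subcritical-mono b≤c sub F F! = ≤-trans
    (∑-mono-≤ (All.universal (λ x → exp-mono-≤ (neg-antitone (*-monoˡ-≤ (<⇒≤ (w-pos x)) b≤c))) F))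
    (sub F F!)

  -- Since `exp 1#` is at least 2, two copies of a term fit under the preceding one. The extra
  -- summand on the left carries this through the induction.
  geometric-sum : ∀ n → ∑ (λ k → exp (- fromℕ (suc k))) (downFrom n) + exp (- fromℕ n) ≤ 1#
  geometric-sum zero = begin
    0# + exp (- 0#)   ≈⟨ +-identityˡ _ ⟩
    exp (- 0#)        ≈⟨ exp-cong (solve 0 (:- :0 := :0) refl) ⟩
    exp 0#            ≈⟨ exp-0 ⟩
    1#                ∎
  geometric-sum (suc n) = begin
    e + s + e                            ≈⟨ solve 2 (λ e s → e :+ s :+ e := s :+ (e :+ e)) refl e s ⟩
    s + (e + e)                          ≤⟨ +-monoʳ-≤ s e+e≤ ⟩
    s + exp (- fromℕ n)                  ≤⟨ geometric-sum n ⟩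
    1#                                   ∎
    where
    e = exp (- fromℕ (suc n))
    s = ∑ (λ k → exp (- fromℕ (suc k))) (downFrom n)
    e+e≤ : e + e ≤ exp (- fromℕ n)
    e+e≤ = begin
      e + e                            ≈⟨ solve 1 (λ e → e :+ e := (:1 :+ :1) :* e) refl e ⟩
      (1# + 1#) * e                    ≤⟨ *-monoˡ-≤ (<⇒≤ (exp-pos _)) (1+x≤exp 1#) ⟩
      exp 1# * e                       ≈⟨ exp-+ 1# (- fromℕ (suc n)) ⟨
      exp (1# - fromℕ (suc n))         ≈⟨ exp-cong (solve 1 (λ m → :1 :- (:1 :+ m) := :- m) refl (fromℕ n)) ⟩
      exp (- fromℕ n)                  ∎

  downFrom-covers : ∀ ks → ∃[ n ] All (λ k → Membership._∈_ (≡.setoid ℕ) k (downFrom n)) ks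
  -- Every entry is at most the sum of all entries. A crude cutoff is enough because `geometric-sum`
  -- is uniform in `n`.
  downFrom-covers ks = suc (ℕ.sum ks) , All.map (∈-downFrom⁺ ∘ ℕ.s≤s) (≤sum ks)
    where
    ≤sum : ∀ ks → All (ℕ._≤ ℕ.sum ks) ks
    ≤sum []       = []
    ≤sum (k ∷ ks) = ℕ.m≤m+n k _ ∷ All.map (λ l≤ → ℕ.≤-trans l≤ (ℕ.m≤n+m _ k)) (≤sum ks)

  -- Distinct letters have distinct levels ⌊w x / τ⌋ - 1, which compares Σ exp (- w x / τ) with Σ exp (- (k + 1)).
  abstract
    level : ∀ x → ∃[ k ] (fromℕ k ≤ τ ⁻¹ * w x - 1# × τ ⁻¹ * w x - 1# < fromℕ (suc k))
    level x = floor (x≤y⇒0≤y-x (begin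
      1#            ≈⟨ *-inverseʳ 0<τ ⟨
      τ * τ ⁻¹      ≈⟨ *-comm _ _ ⟩
      τ ⁻¹ * τ      ≤⟨ *-monoʳ-≤ (<⇒≤ (⁻¹-pos 0<τ)) (τ≤w x) ⟩
      τ ⁻¹ * w x    ∎))

  same-level⇒close : ∀ x y → proj₁ (level x) ≡ proj₁ (level y) → w x - w y ≤ τ
  same-level⇒close x y kx≡ky = *-cancelˡ-≤ (⁻¹-pos 0<τ) (begin
    τ ⁻¹ * (w x - w y)
      ≈⟨ solve 3 (λ c x y → c :* (x :- y) := c :* x :- :1 :- (c :* y :- :1)) refl (τ ⁻¹) (w x) (w y) ⟩
    τ ⁻¹ * w x - 1# - (τ ⁻¹ * w y - 1#)
      ≤⟨ +-mono-≤ (<⇒≤ (proj₂ (proj₂ (level x)))) (neg-antitone (proj₁ (proj₂ (level y)))) ⟩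
    1# + fromℕ kx - fromℕ ky                    ≡⟨ ≡.cong (λ k → 1# + fromℕ kx - fromℕ k) kx≡ky ⟨
    1# + fromℕ kx - fromℕ kx                    ≈⟨ solve 1 (λ k → :1 :+ k :- k := :1) refl (fromℕ kx) ⟩
    1#                                          ≈⟨ *-inverseʳ 0<τ ⟨
    τ * τ ⁻¹                                    ≈⟨ *-comm τ (τ ⁻¹) ⟩
    τ ⁻¹ * τ                                    ∎)
    where
    kx = proj₁ (level x)
    ky = proj₁ (level y)

  close⇒≈ : ∀ x y → w x - w y ≤ τ → w y - w x ≤ τ → x ≈ₐ y
  close⇒≈ x y x-y≤τ y-x≤τ with em₀ {x ≈ₐ y}
  ... | yes x≈y = x≈y
  ... | no  x≉y = contradiction τ<∣x-y∣ (λ τ<∣x-y∣ → <⇒≱ τ<∣x-y∣ ∣x-y∣≤τ)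
    where
    τ<∣x-y∣ : τ < ∣ w x - w y ∣
    τ<∣x-y∣ = begin-strict
      τ               ≤⟨ τ≤δ ⟩
      δ               <⟨ separated x y x≉y ⟩
      ∣ w x - w y ∣   ∎
    ∣x-y∣≤τ : ∣ w x - w y ∣ ≤ τ
    ∣x-y∣≤τ with ∣x∣-sel (w x - w y)
    ... | inj₁ e = ≤-trans (≤-reflexive e) x-y≤τ
    ... | inj₂ e = begin
      ∣ w x - w y ∣   ≈⟨ e ⟩
      - (w x - w y)   ≈⟨ solve 2 (λ x y → :- (x :- y) := y :- x) refl (w x) (w y) ⟩
      w y - w x       ≤⟨ y-x≤τ ⟩
      τ               ∎

  level-injective : ∀ {x y} → proj₁ (level x) ≡ proj₁ (level y) → x ≈ₐ y
  level-injective {x} {y} kx≡ky =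
    close⇒≈ x y (same-level⇒close x y kx≡ky) (same-level⇒close y x (≡.sym kx≡ky))

  subcritical-τ⁻¹ : Subcritical (τ ⁻¹)
  subcritical-τ⁻¹ F F! = begin
    ∑ (charge (τ ⁻¹) ∘ w) F                  ≤⟨ ∑-mono-≤ (All.universal charge≤ F) ⟩
    ∑ (g ∘ proj₁ ∘ level) F                  ≡⟨ ∑-map g (proj₁ ∘ level) F ⟨
    ∑ g (map (proj₁ ∘ level) F)              ≤⟨ ∑-⊆ (≡.setoid ℕ) (λ { ≡.refl → refl }) (λ _ → <⇒≤ (exp-pos _))
                                                  (Unique.map⁺ A (≡.setoid ℕ) level-injective F!) (proj₂ cover) ⟩
    ∑ g (downFrom (proj₁ cover))             ≈⟨ +-identityʳ _ ⟨
    ∑ g (downFrom (proj₁ cover)) + 0#        ≤⟨ +-monoʳ-≤ _ (<⇒≤ (exp-pos _)) ⟩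
    _                                        ≤⟨ geometric-sum (proj₁ cover) ⟩
    1#                                       ∎
    where
    g : ℕ → ℝ
    g k = exp (- fromℕ (suc k))
    cover = downFrom-covers (map (proj₁ ∘ level) F)
    charge≤ : ∀ x → charge (τ ⁻¹) (w x) ≤ g (proj₁ (level x))
    charge≤ x = exp-mono-≤ (neg-antitone (begin
      1# + fromℕ (proj₁ (level x))   ≤⟨ +-monoʳ-≤ 1# (proj₁ (proj₂ (level x))) ⟩
      1# + (τ ⁻¹ * w x - 1#)         ≈⟨ solve 1 (λ t → :1 :+ (t :- :1) := t) refl _ ⟩
      τ ⁻¹ * w x                     ∎))

  -- Upper bound: the total charge of all words.

  words : List Letter → ℕ → List Word
  words F zero    = [] ∷ []
  words F (suc n) = [] ∷ cartesianProductWith _∷_ F (words F n)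

  ∈-words : ∀ {F n v} → All (_∈ₐ F) v → length v ℕ.≤ n → v ∈ʷ words F n
  ∈-words {n = zero}  []          _             = here []
  ∈-words {n = suc n} []          _             = here []
  ∈-words {n = suc n} (x∈F ∷ v⊆F) (ℕ.s≤s ∣v∣≤n) =
    there (∈.∈-cartesianProductWith⁺ A wordSetoid wordSetoid _∷_ x∈F (∈-words v⊆F ∣v∣≤n))

  all-in-concat : ∀ vs → All (λ v → All (_∈ₐ concat vs) v × length v ℕ.≤ length (concat vs)) vs
  all-in-concat []       = []
  all-in-concat (v ∷ vs) =
    (All.tabulateₛ A ++⁺ˡ , ℕ.≤-trans (ℕ.m≤m+n _ _) (ℕ.≤-reflexive (≡.sym (length-++ v)))) ∷
    All.map (λ (v′⊆ , ∣v′∣≤) → All.map (++⁺ʳ v) v′⊆ ,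
              ℕ.≤-trans ∣v′∣≤ (ℕ.≤-trans (ℕ.m≤n+m _ (length v)) (ℕ.≤-reflexive (≡.sym (length-++ v)))))
            (all-in-concat vs)

  -- Finitely many words involve finitely many letters, and their concatenation bounds each of their
  -- lengths. Repeated letters are removed so that `Subcritical` applies to the resulting alphabet.
  words-cover : ∀ vs → ∃[ F ] (Unique A F × ∃[ n ] All (_∈ʷ words F n) vs)
  words-cover vs = deduplicate _≟_ (concat vs) , DecUnique.deduplicate-! decLetters (concat vs) ,
    length (concat vs) ,
    All.map (λ (v⊆ , ∣v∣≤) → ∈-words (All.map ∈-letters v⊆) ∣v∣≤) (all-in-concat vs)
    where
    _≟_ : ∀ x y → Dec (x ≈ₐ y)
    x ≟ y = em₀
    decLetters : DecSetoid a 0ℓ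
    decLetters = record { isDecEquivalence = record { isEquivalence = Setoid.isEquivalence A ; _≟_ = _≟_ } }
    ∈-letters : ∀ {x xs} → x ∈ₐ xs → x ∈ₐ deduplicate _≟_ xs
    ∈-letters = ∈.∈-deduplicate⁺ A _≟_ (λ z≈y x≈y → Setoid.trans A x≈y (Setoid.sym A z≈y))

  -- Convergence at `b` of the Dirichlet series of the free monoid on the letters, again expressed
  -- through finite partial sums.
  BoundedCharge : ℝ → Set a
  BoundedCharge b = ∃[ M ] (0# < M × ∀ vs → Unique wordSetoid vs → ∑ (charge b ∘ weight) vs ≤ M)

  -- Each letter costs at least an extra factor q = exp (- ε τ) < 1, so the total charge
  -- of words by length is dominated by a geometric series in q.
  subcritical⇒bounded : ∀ {b c} → b < c → Subcritical b → BoundedCharge c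
  subcritical⇒bounded {b} {c} b<c sub = M , 0<M , λ vs vs! → let F , F! , n , vs⊆ = words-cover vs in begin
    ∑ (charge c ∘ weight) vs
      ≤⟨ ∑-⊆ wordSetoid (charge-cong c ∘ weight-cong) (λ v → charge-nonNeg c _) vs! vs⊆ ⟩
    ∑ (charge c ∘ weight) (words F n)    ≤⟨ ∑-words F F! n ⟩
    M                                    ∎
    where
    ε = c - b
    q = charge ε τ
    M = (1# - q) ⁻¹

    0<ε : 0# < ε
    0<ε = x<y⇒0<y-x b<c

    q<1 : q < 1#
    q<1 = ≰⇒> λ 1≤q → <⇒≱ (*-pos 0<ε 0<τ) (begin
      ε * τ          ≈⟨ solve 1 (λ t → t := :- :- t) refl (ε * τ) ⟩
      - - (ε * τ)    ≤⟨ neg-antitone (exp-cancel-≤ (≤-trans (≤-reflexive exp-0) 1≤q)) ⟩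
      - 0#           ≈⟨ solve 0 (:- :0 := :0) refl ⟩
      0#             ∎)

    0<M : 0# < M
    0<M = ⁻¹-pos (x<y⇒0<y-x q<1)

    0≤M : 0# ≤ M
    0≤M = <⇒≤ 0<M

    -- `M` is the fixed point of t ↦ 1 + q t. One more letter of length applies this map to the
    -- bound, so the same `M` works for every length.
    1+qM≤M : 1# + q * M ≤ M
    1+qM≤M = begin
      1# + q * M                ≈⟨ +-congʳ (*-inverseʳ (x<y⇒0<y-x q<1)) ⟨
      (1# - q) * M + q * M      ≈⟨ solve 2 (λ q M → (:1 :- q) :* M :+ q :* M := M) refl q M ⟩
      M                         ∎

    ∑-letters : ∀ F → Unique A F → ∑ (charge c ∘ w) F ≤ q
    ∑-letters F F! = begin
      ∑ (charge c ∘ w) F                   ≤⟨ ∑-mono-≤ (All.universal factor F) ⟩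
      ∑ (λ x → q * charge b (w x)) F       ≈⟨ ∑-*ˡ q (charge b ∘ w) F ⟩
      q * ∑ (charge b ∘ w) F               ≤⟨ *-monoʳ-≤ (charge-nonNeg ε τ) (sub F F!) ⟩
      q * 1#                               ≈⟨ *-identityʳ q ⟩
      q                                    ∎
      where
      factor : ∀ x → charge c (w x) ≤ q * charge b (w x)
      factor x = begin
        charge c (w x)
          ≈⟨ exp-cong (solve 3 (λ b c t → :- (c :* t) := :- ((c :- b) :* t) :+ :- (b :* t)) refl b c (w x)) ⟩
        exp (- (ε * w x) - b * w x)      ≈⟨ exp-+ _ _ ⟩
        charge ε (w x) * charge b (w x)  ≤⟨ *-monoˡ-≤ (charge-nonNeg b _) (charge-antitone (<⇒≤ 0<ε) (τ≤w x)) ⟩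
        q * charge b (w x)               ∎

    charge-[] : charge c 0# ≈ 1#
    charge-[] = trans (exp-cong (solve 1 (λ c → :- (c :* :0) := :0) refl c)) exp-0

    ∑-words : ∀ F → Unique A F → ∀ n → ∑ (charge c ∘ weight) (words F n) ≤ M
    ∑-words F F! zero = begin
      charge c 0# + 0#    ≈⟨ +-congʳ charge-[] ⟩
      1# + 0#             ≤⟨ +-monoʳ-≤ 1# (*-nonNeg (charge-nonNeg ε τ) 0≤M) ⟩
      1# + q * M          ≤⟨ 1+qM≤M ⟩
      M                   ∎
    ∑-words F F! (suc n) = begin
      charge c 0# + ∑ (charge c ∘ weight) (cartesianProductWith _∷_ F (words F n))
        ≈⟨ +-cong charge-[] (∑-cartesianProductWith _∷_ (charge c ∘ w) (charge c ∘ weight) (charge c ∘ weight)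
             (λ x v → charge-+ c (w x) (weight v)) F (words F n)) ⟩
      1# + ∑ (charge c ∘ w) F * ∑ (charge c ∘ weight) (words F n)
        ≤⟨ +-monoʳ-≤ 1# (*-mono-≤ (∑-nonNeg (λ x → charge-nonNeg c _) F) 0≤M (∑-letters F F!) (∑-words F F! n)) ⟩
      1# + q * M
        ≤⟨ 1+qM≤M ⟩
      M ∎

  -- Rankin's trick: a word of weight at most `T` has charge at least `charge b T`, so the bounded
  -- total charge limits the number of such words.
  count-≤ : ∀ {b} → 0# ≤ b → (bounded : BoundedCharge b) → ∀ {T vs} →
            Unique wordSetoid vs → All (λ v → weight v ≤ T) vs →
            fromℕ (length vs) ≤ proj₁ bounded * exp (b * T)
  count-≤ {b} 0≤b (M , _ , bound) {T} {vs} vs! vs≤T = begin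
    fromℕ (length vs)                                  ≈⟨ *-identityʳ _ ⟨
    fromℕ (length vs) * 1#                             ≈⟨ *-congˡ (exp-inverse _) ⟨
    fromℕ (length vs) * (exp (b * T) * charge b T)
      ≈⟨ solve 3 (λ l e c → l :* (e :* c) := l :* c :* e) refl _ _ _ ⟩
    fromℕ (length vs) * charge b T * exp (b * T)       ≈⟨ *-congʳ (∑-const (charge b T) vs) ⟨
    ∑ (const (charge b T)) vs * exp (b * T)
      ≤⟨ *-monoˡ-≤ (<⇒≤ (exp-pos _)) (∑-mono-≤ (All.map (charge-antitone 0≤b) vs≤T)) ⟩
    ∑ (charge b ∘ weight) vs * exp (b * T)             ≤⟨ *-monoˡ-≤ (<⇒≤ (exp-pos _)) (bound vs vs!) ⟩
    M * exp (b * T)                                    ∎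

  -- Lower bound: splitting words at the first letter.

  Family : ℝ → ℝ → Set a
  Family T N = ∃[ vs ] (Unique wordSetoid vs × All (λ v → weight v ≤ T) vs × N ≤ fromℕ (length vs))

  StartsIn : List Letter → Word → Set a
  StartsIn G v = Maybe.Any (_∈ₐ G) (head v)

  startsIn-resp : ∀ {G} → StartsIn G Respects _≋_
  startsIn-resp (x≈y ∷ _) (just x∈G) = just (∈.∈-resp-≈ A x≈y x∈G)

  weaken-start : ∀ {x G} v → StartsIn G v → StartsIn (x ∷ G) v
  weaken-start (_ ∷ _) (just y∈G) = just (there y∈G)

  -- Blocks of words with different first letters are disjoint, so their sizes add up; `StartsIn`
  -- records the first letters for the induction on `G`. Sizes are bounded below by real numbers so
  -- that the fractional shares `charge b (w x) * N` can be summed.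
  prefix-families : ∀ {b T N} G → Unique A G →
    All (λ x → Family (T - w x) (charge b (w x) * N)) G →
    ∃[ vs ] (Unique wordSetoid vs × All (λ v → weight v ≤ T) vs × All (StartsIn G) vs ×
             ∑ (charge b ∘ w) G * N ≤ fromℕ (length vs))
  prefix-families {N = N} [] [] [] = [] , [] , [] , [] , ≤-reflexive (zeroˡ N)
  prefix-families {b} {T} {N} (x ∷ G) (x∉G ∷ G!) ((us , us! , us≤ , ∣us∣) ∷ families)
    with prefix-families G G! families
  ... | vs , vs! , vs≤ , vs-start , ∣vs∣ =
    map (x ∷_) us ++ vs ,
    Unique.++⁺ wordSetoid (Unique.map⁺ wordSetoid wordSetoid (λ { (_ ∷ u≋v) → u≋v }) us!) vs! disjoint ,
    All.++⁺ (All.map⁺ (All.map (λ {v} → prefix≤ {v}) us≤)) vs≤ ,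
    All.++⁺ (All.map⁺ (All.universal (λ _ → just (here (Setoid.refl A))) us))
            (All.map (λ {v} → weaken-start v) vs-start) ,
    (begin
      (charge b (w x) + ∑ (charge b ∘ w) G) * N       ≈⟨ distribʳ _ _ _ ⟩
      charge b (w x) * N + ∑ (charge b ∘ w) G * N     ≤⟨ +-mono-≤ ∣us∣ ∣vs∣ ⟩
      fromℕ (length us) + fromℕ (length vs)
        ≡⟨ ≡.cong (λ k → fromℕ k + fromℕ (length vs)) (length-map (x ∷_) us) ⟨
      fromℕ (length (map (x ∷_) us)) + fromℕ (length vs)    ≈⟨ fromℕ-+ (length (map (x ∷_) us)) (length vs) ⟨
      fromℕ (length (map (x ∷_) us) ℕ.+ length vs)    ≡⟨ ≡.cong fromℕ (length-++ (map (x ∷_) us)) ⟨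
      fromℕ (length (map (x ∷_) us ++ vs))            ∎)
    where
    prefix≤ : ∀ {v} → weight v ≤ T - w x → w x + weight v ≤ T
    prefix≤ {v} v≤ = begin
      w x + weight v     ≤⟨ +-monoʳ-≤ (w x) v≤ ⟩
      w x + (T - w x)    ≈⟨ solve 2 (λ x T → x :+ (T :- x) := T) refl (w x) T ⟩
      T                  ∎

    disjoint : ∀ {v} → ¬ (v ∈ʷ map (x ∷_) us × v ∈ʷ vs)
    disjoint (v∈us , v∈vs)
      with ∈.∈-map⁻ wordSetoid wordSetoid v∈us | All.lookupₛ wordSetoid startsIn-resp vs-start v∈vs
    ... | _ , _ , (y≈x ∷ _) | just y∈G = ∈.All[≉]⇒∉ A x∉G (∈.∈-resp-≈ A y≈x y∈G)

  Growing : ℝ → Set a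
  Growing b = ∃[ c ] (0# < c × ∀ T → 0# ≤ T → ∃[ vs ]
    (Unique wordSetoid vs × All (λ v → weight v ≤ T) vs × exp (b * T) ≤ c * fromℕ (length vs)))

  -- The bound exp (b (T - m)) on the number of words is inherited from the tails: the shares of the
  -- first letters in `F` sum to at least the whole. Every split lowers `T` by at least `τ`, so `n`
  -- bounds the depth of the recursion.
  supercritical⇒growing : ∀ {b} → 0# ≤ b → Supercritical b → Growing b
  supercritical⇒growing {b} 0≤b (F , F! , 1≤∑) = exp (b * m) , exp-pos _ , λ T 0≤T →
    let n , T-m≤nτ = archimedean-multiple (T - m) 0<τ
        vs , vs! , vs≤ , ∣vs∣ = tree n T 0≤T (begin
          T                    ≈⟨ solve 2 (λ T m → T := m :+ (T :- m)) refl T m ⟩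
          m + (T - m)          ≤⟨ +-monoʳ-≤ m T-m≤nτ ⟩
          m + fromℕ n * τ      ∎)
    in vs , vs! , vs≤ , (begin
      exp (b * T)
        ≈⟨ exp-cong (solve 3 (λ b T m → b :* T := b :* m :+ b :* (T :- m)) refl b T m) ⟩
      exp (b * m + b * (T - m))             ≈⟨ exp-+ _ _ ⟩
      exp (b * m) * exp (b * (T - m))       ≤⟨ *-monoʳ-≤ (<⇒≤ (exp-pos _)) ∣vs∣ ⟩
      exp (b * m) * fromℕ (length vs)       ∎)
    where
    m : ℝ
    -- The sum of the weights dominates each one of them. Hence `T - w x` stays nonnegative when a
    -- word is split with `T > m`.
    m = weight F

    letters≤ : ∀ G → All (λ x → w x ≤ weight G) G
    letters≤ []      = []
    letters≤ (x ∷ G) =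
      by-difference (solve 2 (λ x g → x :+ g :- x := g) refl (w x) (weight G)) (weight-nonNeg G) ∷
      All.map (λ wy≤ → ≤-trans wy≤ (by-difference
                (solve 2 (λ x g → x :+ g :- g := x) refl (w x) (weight G)) (<⇒≤ (w-pos x))))
              (letters≤ G)

    -- For `T ≤ m` the required size is at most 1, and the empty word alone suffices.
    leaf : ∀ {T} → 0# ≤ T → T ≤ m → Family T (exp (b * (T - m)))
    leaf {T} 0≤T T≤m = ([] ∷ []) , ([] ∷ []) , (0≤T ∷ []) , (begin
      exp (b * (T - m))     ≤⟨ exp-mono-≤ (begin
        b * (T - m)         ≤⟨ *-monoʳ-≤ 0≤b (+-mono-≤ T≤m ≤-refl) ⟩
        b * (m - m)         ≈⟨ solve 2 (λ b m → b :* (m :- m) := :0) refl b m ⟩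
        0#                  ∎) ⟩
      exp 0#                ≈⟨ exp-0 ⟩
      1#                    ≈⟨ +-identityʳ 1# ⟨
      1# + 0#               ∎)

    node : ∀ {T} → (∀ {x} → w x ≤ m → Family (T - w x) (exp (b * (T - w x - m)))) →
           Family T (exp (b * (T - m)))
    node {T} subtree =
      let vs , vs! , vs≤ , _ , ∣vs∣ = prefix-families {b} {T} {exp (b * (T - m))} F F! (All.map rescale (letters≤ F))
      in vs , vs! , vs≤ , (begin
        exp (b * (T - m))                            ≈⟨ *-identityˡ _ ⟨
        1# * exp (b * (T - m))                       ≤⟨ *-monoˡ-≤ (<⇒≤ (exp-pos _)) 1≤∑ ⟩
        ∑ (charge b ∘ w) F * exp (b * (T - m))       ≤⟨ ∣vs∣ ⟩
        fromℕ (length vs)                            ∎)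
      where
      rescale : ∀ {x} → w x ≤ m → Family (T - w x) (charge b (w x) * exp (b * (T - m)))
      rescale {x} wx≤m = let vs , vs! , vs≤ , ∣vs∣ = subtree wx≤m in vs , vs! , vs≤ , (begin
        charge b (w x) * exp (b * (T - m))    ≈⟨ exp-+ _ _ ⟨
        exp (- (b * w x) + b * (T - m))
          ≈⟨ exp-cong (solve 4 (λ b x T m → :- (b :* x) :+ b :* (T :- m) := b :* (T :- x :- m)) refl b (w x) T m) ⟩
        exp (b * (T - w x - m))               ≤⟨ ∣vs∣ ⟩
        fromℕ (length vs)                     ∎)

    tree : ∀ n T → 0# ≤ T → T ≤ m + fromℕ n * τ → Family T (exp (b * (T - m)))
    tree zero    T 0≤T T≤m+0 = leaf 0≤T (begin
      T              ≤⟨ T≤m+0 ⟩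
      m + 0# * τ     ≈⟨ solve 2 (λ m t → m :+ :0 :* t := m) refl m τ ⟩
      m              ∎)
    tree (suc n) T 0≤T T≤m+[1+n]τ = [ leaf 0≤T , (λ m<T → node λ {x} wx≤m →
      tree n (T - w x) (x≤y⇒0≤y-x (≤-trans wx≤m (<⇒≤ m<T))) (begin
        T - w x                               ≤⟨ +-mono-≤ T≤m+[1+n]τ (neg-antitone (τ≤w x)) ⟩
        m + (1# + fromℕ n) * τ - τ
          ≈⟨ solve 3 (λ m n t → m :+ (:1 :+ n) :* t :- t := m :+ n :* t) refl m (fromℕ n) τ ⟩
        m + fromℕ n * τ                       ∎)) ]′ (≤-<-connex T m)

  -- Choice of the exponents.

  two-letters⇒supercritical : ∀ {x y} → x ≉ₐ y → ∃[ b ] (0# < b × Supercritical b)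
  -- By `1+x≤exp` the two charges sum to at least 2 - b (w x + w y), which equals 1 for this `b`.
  two-letters⇒supercritical {x} {y} x≉y = b , ⁻¹-pos 0<s , x ∷ y ∷ [] , ((x≉y ∷ []) ∷ [] ∷ []) , (begin
    1#                                           ≈⟨ solve 0 (:1 := :1 :+ :1 :- :1) refl ⟩
    1# + 1# - 1#                                 ≈⟨ +-congˡ (-‿cong (*-inverseʳ 0<s)) ⟨
    1# + 1# - s * b
      ≈⟨ solve 3 (λ x y b → :1 :+ :1 :- (x :+ y) :* b := (:1 :- b :* x) :+ ((:1 :- b :* y) :+ :0))
           refl (w x) (w y) b ⟩
    (1# - b * w x) + ((1# - b * w y) + 0#)       ≤⟨ +-mono-≤ (1+x≤exp _) (+-mono-≤ (1+x≤exp _) ≤-refl) ⟩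
    charge b (w x) + (charge b (w y) + 0#)       ∎)
    where
    s = w x + w y
    b = s ⁻¹
    0<s : 0# < s
    0<s = begin-strict
      0#          <⟨ w-pos x ⟩
      w x         ≈⟨ +-identityʳ (w x) ⟨
      w x + 0#    ≤⟨ +-monoʳ-≤ (w x) (<⇒≤ (w-pos y)) ⟩
      s           ∎

  -- Walking from b in steps of ε, the last supercritical point is near the critical exponent.
  near-critical : ∀ {b ε} → 0# < b → 0# < ε → Supercritical b →
                  ∃[ c ] (0# < c × Supercritical c × Subcritical (c + ε))
  near-critical {b} {ε} 0<b 0<ε super =
    let n , τ⁻¹≤nε = archimedean-multiple (τ ⁻¹) 0<ε in walk n 0<b super (subcritical-mono (begin
    τ ⁻¹            ≤⟨ τ⁻¹≤nε ⟩
    fromℕ n * ε     ≈⟨ +-identityˡ _ ⟨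
    0# + fromℕ n * ε    ≤⟨ +-mono-≤ (<⇒≤ 0<b) ≤-refl ⟩
    b + fromℕ n * ε ∎) subcritical-τ⁻¹)
    where
    walk : ∀ n {b} → 0# < b → Supercritical b → Subcritical (b + fromℕ n * ε) →
           ∃[ c ] (0# < c × Supercritical c × Subcritical (c + ε))
    walk zero    {b} 0<b super sub = b , 0<b , super , subcritical-mono (+-monoʳ-≤ b (begin
      0# * ε    ≈⟨ zeroˡ ε ⟩
      0#        ≤⟨ <⇒≤ 0<ε ⟩
      ε         ∎)) sub
    walk (suc n) {b} 0<b super sub = [ (λ sub′ → b , 0<b , super , sub′) , (λ super′ → walk n (begin-strict
        0#        <⟨ 0<b ⟩
        b         ≈⟨ +-identityʳ b ⟨
        b + 0#    ≤⟨ +-monoʳ-≤ b (<⇒≤ 0<ε) ⟩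
        b + ε     ∎) super′
      (subcritical-mono (≤-reflexive
        (solve 3 (λ b n ε → b :+ (:1 :+ n) :* ε := b :+ ε :+ n :* ε) refl b (fromℕ n) ε)) sub)) ]′
      (sub-or-supercritical (b + ε))

  growth-exponent : ∀ {x y ε} → x ≉ₐ y → 0# < ε →
                    ∃[ b ] (0# < b × Growing b × BoundedCharge (b + ε))
  growth-exponent {ε = ε} x≉y 0<ε =
    let b₀ , 0<b₀ , super₀       = two-letters⇒supercritical x≉y
        -- Subcriticality at `b + ε′` bounds the charge only at strictly larger exponents; choosing
        -- `ε′` below `ε` leaves that room.
        ε′ , 0<ε′ , ε′<ε         = positive-below 0<ε
        b  , 0<b  , super , sub  = near-critical 0<b₀ 0<ε′ super₀
    in b , 0<b , supercritical⇒growing (<⇒≤ 0<b) super , subcritical⇒bounded (+-monoʳ-< b ε′<ε) sub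

  bounded-exponent : ∃[ b ] (0# < b × BoundedCharge b)
  bounded-exponent = 1# + τ ⁻¹ , ≰⇒> (λ ≤0 → <⇒≱ (⁻¹-pos 0<τ) (≤-trans (<⇒≤ (x<1+x _)) ≤0)) ,
    subcritical⇒bounded (x<1+x (τ ⁻¹)) subcritical-τ⁻¹

-- From words to endomorphisms, and the growth of heights along orbits.

module OrbitCounting
  (em : ExcludedMiddle (lsuc 0ℓ)) (R : RealNumbers) {K : Field} (gf : GlobalField K) (K̄ : AlgebraicClosure K)
  (V : ProjectiveSet K) (η : Heights.Picℝ R gf K̄ V) (h : Geometry.Point K̄ V → RealNumbers.Carrier R)
  (h-cong : ∀ {P Q} → Geometry._≈ₚ_ K̄ P Q → RealNumbers._≈_ R (h P) (h Q))
  (S : Pred (Geometry.Endo K̄ V) 0ℓ) (S-uld : Heights.UniformlyLogDiscrete R gf K̄ η h S)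
  where

  open RealNumbers R renaming (Carrier to ℝ)
  open Geometry K̄
  open Heights R gf K̄
  open RealAnalysis (lower-em {b = lsuc 0ℓ} em) R
  open Sums (lower-em {b = lsuc 0ℓ} em) R
  open ≤R
  open UniformlyLogDiscrete S-uld using (d; d-cong; d>1; sup<∞; logDiscrete)

  -- A letter carries its membership proof because `d` takes it as an argument. Equality looks only
  -- at the endomorphism, and `d-cong` makes the weight compatible with that.
  letters : Setoid (lsuc 0ℓ) 0ℓ
  letters = On.setoid {B = ∃[ φ ] φ ∈ S} (endos V) proj₁

  open Setoid letters using () renaming (Carrier to Letter)

  logDegree : Letter → ℝ
  logDegree (φ , s) = log (d φ s)

  d-pos : ∀ φ s → 0# < d φ s
  d-pos φ s = begin-strict 0# <⟨ 0<1 ⟩ 1# <⟨ d>1 φ s ⟩ d φ s ∎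

  logDegree-cong : ∀ {l m : Letter} → proj₁ l ≈ₑ proj₁ m → logDegree l ≈ logDegree m
  logDegree-cong {φ , s} {ψ , t} φ≈ψ = log-cong (d-pos φ s) (d-cong s t φ≈ψ)

  logDegree-pos : ∀ l → 0# < logDegree l
  logDegree-pos (φ , s) = log-pos (d>1 φ s)

  δ : ℝ
  δ = proj₁ logDiscrete

  logDegree-separated : ∀ (l m : Letter) → ¬ proj₁ l ≈ₑ proj₁ m → δ < ∣ logDegree l - logDegree m ∣
  logDegree-separated (φ , s) (ψ , t) = proj₂ (proj₂ logDiscrete) φ ψ s t

  open WordCounting em R letters logDegree (λ {l} {m} → logDegree-cong {l} {m}) logDegree-pos
    δ (proj₁ (proj₂ logDiscrete)) logDegree-separated
    hiding (em₀)

  open Setoid wordSetoid using () renaming (_≈_ to _≋_)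

  ⟪_⟫ : Word → Endo V
  ⟪ v ⟫ = compose (map proj₁ v)

  ⟪⟫-cong : ∀ {u v} → u ≋ v → ⟪ u ⟫ ≈ₑ ⟪ v ⟫
  ⟪⟫-cong []                                P = Setoid.refl (points V) {P}
  ⟪⟫-cong {(φ , _) ∷ u} {(ψ , _) ∷ v} (φ≈ψ ∷ u≋v) P =
    Setoid.trans (points V) {to φ (to ⟪ u ⟫ P)} {to φ (to ⟪ v ⟫ P)} {to ψ (to ⟪ v ⟫ P)}
      (to-cong φ {to ⟪ u ⟫ P} {to ⟪ v ⟫ P} (⟪⟫-cong u≋v P)) (φ≈ψ (to ⟪ v ⟫ P))

  ⟪⟫-generated : ∀ v → ⟪ v ⟫ ∈ GeneratedMonoid S
  ⟪⟫-generated v = map proj₁ v , All.map⁺ (All.universal proj₂ v) , Setoid.refl (endos V) {⟪ v ⟫}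

  map-proj₁-toList : ∀ {θs} (θs∈S : All S θs) → map proj₁ (All.toList θs∈S) ≡ θs
  map-proj₁-toList []             = ≡.refl
  map-proj₁-toList (_ ∷ θs∈S)     = ≡.cong (_ ∷_) (map-proj₁-toList θs∈S)

  generated⇒⟪⟫ : ∀ {f} → f ∈ GeneratedMonoid S → ∃[ v ] f ≈ₑ ⟪ v ⟫
  generated⇒⟪⟫ {f} (θs , θs∈S , f≈) =
    All.toList θs∈S , ≡.subst (λ τs → f ≈ₑ compose τs) (≡.sym (map-proj₁-toList θs∈S)) f≈

  -- Heights along words.

  C : ℝ
  -- The absolute value makes the common error bound nonnegative, as `0≤A` requires.
  C = ∣ proj₁ sup<∞ ∣

  -- Large enough that (d - 1) A ≥ C for every multiplier d, so that A absorbs the errors C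
  -- accumulated along an orbit.
  A : ℝ
  A = C * τ ⁻¹

  0≤A : 0# ≤ A
  0≤A = *-nonNeg (0≤∣x∣ _) (<⇒≤ (⁻¹-pos 0<τ))

  module _ (l : Letter) (Q : Point V) where
    private
      φ = proj₁ l
      e = exp (logDegree l)
      μ = h (to φ Q) - e * h Q

    -- The factor `e - 1#` is at least `logDegree l`, hence at least `τ`, and `τ * A` is `C`.
    C≤[e-1]A : C ≤ (e - 1#) * A
    C≤[e-1]A = begin
      C               ≈⟨ *-identityʳ C ⟨
      C * 1#          ≈⟨ *-congˡ (*-inverseʳ 0<τ) ⟨
      C * (τ * τ ⁻¹)  ≈⟨ solve 3 (λ c t u → c :* (t :* u) := t :* (c :* u)) refl C τ (τ ⁻¹) ⟩
      τ * A           ≤⟨ *-monoˡ-≤ 0≤A (begin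
        τ                       ≤⟨ τ≤w l ⟩
        logDegree l             ≈⟨ solve 1 (λ t → t := :1 :+ t :- :1) refl (logDegree l) ⟩
        1# + logDegree l - 1#   ≤⟨ +-mono-≤ (1+x≤exp _) ≤-refl ⟩
        e - 1#                  ∎) ⟩
      (e - 1#) * A    ∎

    ∣μ∣≤C : ∣ h (to φ Q) - d φ (proj₂ l) * h Q ∣ ≤ C
    ∣μ∣≤C = let c , (bound , _) , c≤M = proj₂ sup<∞ φ (proj₂ l) in ≤-trans (bound Q) (≤-trans c≤M (x≤∣x∣ _))

    μ≈ : μ ≈ h (to φ Q) - d φ (proj₂ l) * h Q
    μ≈ = +-congˡ (-‿cong (*-congʳ (exp-log (d-pos φ (proj₂ l)))))

    -- Shifting the height by `A` leaves a surplus `(e - 1#) * A`, which covers the error `C`. The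
    -- shifted inequality has no error term, so it can be iterated along a word; `letter-height-≤`
    -- shifts the other way.
    letter-height-≥ : e * (h Q - A) ≤ h (to φ Q) - A
    letter-height-≥ = by-difference
      (solve 5 (λ k e q a c → k :- a :- e :* (q :- a) := (c :- :- (k :- e :* q)) :+ ((e :- :1) :* a :- c))
         refl (h (to φ Q)) e (h Q) A C)
      (+-nonNeg (x≤y⇒0≤y-x (≤-trans (≤-reflexive (-‿cong μ≈)) (≤-trans (-x≤∣x∣ _) ∣μ∣≤C))) (x≤y⇒0≤y-x C≤[e-1]A))

    letter-height-≤ : h (to φ Q) + A ≤ e * (h Q + A)
    letter-height-≤ = by-difference
      (solve 5 (λ k e q a c → e :* (q :+ a) :- (k :+ a) := (c :- (k :- e :* q)) :+ ((e :- :1) :* a :- c))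
         refl (h (to φ Q)) e (h Q) A C)
      (+-nonNeg (x≤y⇒0≤y-x (≤-trans (≤-reflexive μ≈) (≤-trans (x≤∣x∣ _) ∣μ∣≤C))) (x≤y⇒0≤y-x C≤[e-1]A))

  word-height-≥ : ∀ v P → exp (weight v) * (h P - A) ≤ h (to ⟪ v ⟫ P) - A
  word-height-≥ []      P = ≤-reflexive (trans (*-congʳ exp-0) (*-identityˡ _))
  word-height-≥ (l ∷ v) P = begin
    exp (logDegree l + weight v) * (h P - A)          ≈⟨ *-congʳ (exp-+ _ _) ⟩
    exp (logDegree l) * exp (weight v) * (h P - A)    ≈⟨ *-assoc _ _ _ ⟩
    exp (logDegree l) * (exp (weight v) * (h P - A))  ≤⟨ *-monoʳ-≤ (<⇒≤ (exp-pos _)) (word-height-≥ v P) ⟩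
    exp (logDegree l) * (h (to ⟪ v ⟫ P) - A)          ≤⟨ letter-height-≥ l (to ⟪ v ⟫ P) ⟩
    h (to ⟪ l ∷ v ⟫ P) - A                            ∎

  word-height-≤ : ∀ v P → h (to ⟪ v ⟫ P) + A ≤ exp (weight v) * (h P + A)
  word-height-≤ []      P = ≤-reflexive (sym (trans (*-congʳ exp-0) (*-identityˡ _)))
  word-height-≤ (l ∷ v) P = begin
    h (to ⟪ l ∷ v ⟫ P) + A                            ≤⟨ letter-height-≤ l (to ⟪ v ⟫ P) ⟩
    exp (logDegree l) * (h (to ⟪ v ⟫ P) + A)          ≤⟨ *-monoʳ-≤ (<⇒≤ (exp-pos _)) (word-height-≤ v P) ⟩
    exp (logDegree l) * (exp (weight v) * (h P + A))  ≈⟨ *-assoc _ _ _ ⟨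
    exp (logDegree l) * exp (weight v) * (h P + A)    ≈⟨ *-congʳ (exp-+ _ _) ⟨
    exp (logDegree l + weight v) * (h P + A)          ∎

  H : Point V → ℝ
  H P = exp (h P)

  H-cong : ∀ {P Q} → P ≈ₚ Q → H P ≈ H Q
  H-cong {P} {Q} P≈Q = exp-cong (h-cong {P} {Q} P≈Q)

  -- Transfer of word counts to orbit points and endomorphisms.

  module _ {c} (X : Setoid c 0ℓ) (em-X : ExcludedMiddle (c Level.⊔ lsuc 0ℓ)) {decode : Word → Setoid.Carrier X}
           (decode-cong : ∀ {u v} → u ≋ v → Setoid._≈_ X (decode u) (decode v)) where
    open Setoid X using () renaming (Carrier to Code; _≈_ to _≈ˣ_)

    Names : Code → Word → Set
    Names x v = x ≈ˣ decode v

    fresh-name : ∀ {x v xs vs} → Names x v → Pointwise Names xs vs →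
                 All (λ y → ¬ x ≈ˣ y) xs → All (λ u → ¬ v ≋ u) vs
    fresh-name x~v []            []           = []
    fresh-name x~v (y~u ∷ names) (x≉y ∷ x≉xs) =
      (λ v≋u → x≉y (Setoid.trans X x~v (Setoid.trans X (decode-cong v≋u) (Setoid.sym X y~u)))) ∷
      fresh-name x~v names x≉xs

    -- One word is chosen for each element. Equal words decode to equal elements, so distinct
    -- elements receive distinct words, and an upper bound for words is one for elements.
    names : ∀ {T xs} → Unique X xs → All (λ x → ∃[ v ] (Names x v × weight v ≤ T)) xs →
            ∃[ vs ] (Unique wordSetoid vs × All (λ v → weight v ≤ T) vs × Pointwise Names xs vs)
    names []           []                        = [] , [] , [] , []
    names (x≉xs ∷ xs!) ((v , x~v , v≤T) ∷ ps) = let vs , vs! , vs≤T , xs~vs = names xs! ps in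
      v ∷ vs , fresh-name x~v xs~vs x≉xs ∷ vs! , v≤T ∷ vs≤T , x~v ∷ xs~vs

    named⇒enumerable : ∀ {P : Pred Code (lsuc 0ℓ)} → P Respects _≈ˣ_ →
      ∀ {T} → (∀ x → P x → ∃[ v ] (Names x v × weight v ≤ T)) →
      ∀ {b} → 0# ≤ b → (bounded : BoundedCharge b) →
      ∃[ xs ] (Enumerates X P xs × fromℕ (length xs) ≤ proj₁ bounded * exp (b * T))
    named⇒enumerable {P} resp {T} name {b} 0≤b bounded =
      -- The bound on lists without repetitions, rounded up to a natural number, shows that the set
      -- is finite; the real bound is then applied again to the full enumeration.
      let n , ≤n           = archimedean (proj₁ bounded * exp (b * T))
          xs , enum , ps   = bounded⇒enumerable X em-X resp n
                               (λ xs xs! ps → fromℕ-cancel-≤ (≤-trans (count xs! ps) ≤n))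
      in xs , enum , count (Enumerates.unique enum) ps
      where
      count : ∀ {xs} → Unique X xs → All P xs → fromℕ (length xs) ≤ proj₁ bounded * exp (b * T)
      count {xs} xs! ps = let vs , vs! , vs≤T , xs~vs = names xs! (All.map (λ {x} → name x) ps) in begin
        fromℕ (length xs)                  ≡⟨ ≡.cong fromℕ (Pointwise.Pointwise-length xs~vs) ⟩
        fromℕ (length vs)                  ≤⟨ count-≤ 0≤b bounded vs! vs≤T ⟩
        proj₁ bounded * exp (b * T)        ∎

  -- Counting by height for a fixed starting point.

  exp-shift : ∀ b B x → exp (b * (log (log B) - log x)) ≈ exp (- (b * log x)) * log B ^ʳ b
  exp-shift b B x = trans
    (exp-cong (solve 3 (λ b l x → b :* (l :- x) := :- (b :* x) :+ b :* l) refl b (log (log B)) (log x)))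
    (exp-+ _ _)

  module _ (P : Point V) (A<hP : A < h P) where

    x y : ℝ
    x = h P - A
    y = h P + A

    0<x : 0# < x
    0<x = x<y⇒0<y-x A<hP

    0<y : 0# < y
    0<y = begin-strict
      0#         ≤⟨ 0≤A ⟩
      A          <⟨ A<hP ⟩
      h P        ≈⟨ +-identityʳ (h P) ⟨
      h P + 0#   ≤⟨ +-monoʳ-≤ (h P) 0≤A ⟩
      y          ∎

    -- The hypothesis makes both logarithms meaningful: `B` dominates a value of `exp`, and so does
    -- `log B`, which is how `≤-log` obtains positivity.
    H≤⇒weight≤ : ∀ v B → H (to ⟪ v ⟫ P) ≤ B → weight v ≤ log (log B) - log x
    H≤⇒weight≤ v B H≤B = begin
      weight v                    ≈⟨ solve 2 (λ w l → w := w :+ l :- l) refl (weight v) (log x) ⟩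
      weight v + log x - log x    ≤⟨ +-mono-≤ (≤-log (begin
        exp (weight v + log x)       ≈⟨ exp-+ _ _ ⟩
        exp (weight v) * exp (log x) ≈⟨ *-congˡ (exp-log 0<x) ⟩
        exp (weight v) * x           ≤⟨ word-height-≥ v P ⟩
        h (to ⟪ v ⟫ P) - A           ≤⟨ +-monoʳ-≤ (h (to ⟪ v ⟫ P)) (neg-antitone 0≤A) ⟩
        h (to ⟪ v ⟫ P) - 0#          ≈⟨ solve 1 (λ k → k :- :0 := k) refl (h (to ⟪ v ⟫ P)) ⟩
        h (to ⟪ v ⟫ P)               ≤⟨ ≤-log H≤B ⟩
        log B                        ∎)) ≤-refl ⟩
      log (log B) - log x         ∎

    weight≤⇒H≤ : ∀ v B → 0# < B → 0# < log B → weight v ≤ log (log B) - log y → H (to ⟪ v ⟫ P) ≤ B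
    weight≤⇒H≤ v B 0<B 0<logB v≤ = begin
      exp (h (to ⟪ v ⟫ P))      ≤⟨ exp-mono-≤ (begin
        h (to ⟪ v ⟫ P)                     ≈⟨ +-identityʳ _ ⟨
        h (to ⟪ v ⟫ P) + 0#                ≤⟨ +-monoʳ-≤ _ 0≤A ⟩
        h (to ⟪ v ⟫ P) + A                 ≤⟨ word-height-≤ v P ⟩
        exp (weight v) * y                 ≈⟨ *-congˡ (exp-log 0<y) ⟨
        exp (weight v) * exp (log y)       ≈⟨ exp-+ _ _ ⟨
        exp (weight v + log y)             ≤⟨ exp-mono-≤ (+-mono-≤ v≤ ≤-refl) ⟩
        exp (log (log B) - log y + log y)
          ≈⟨ exp-cong (solve 2 (λ l k → l :- k :+ k := l) refl (log (log B)) (log y)) ⟩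
        exp (log (log B))                  ≈⟨ exp-log 0<logB ⟩
        log B                              ∎) ⟩
      exp (log B)               ≈⟨ exp-log 0<B ⟩
      B                         ∎

    -- The shift by `log x` in the weight bound becomes a constant factor. The estimate holds for
    -- every `B`, so the threshold `0#` is an arbitrary choice.
    upper-≪ : ∀ {b} (bounded : BoundedCharge b) (N : ℝ → ℕ) →
              (∀ B → fromℕ (N B) ≤ proj₁ bounded * exp (b * (log (log B) - log x))) →
              (λ B → fromℕ (N B)) ≪ (λ B → log B ^ʳ b)
    upper-≪ {b} (M , 0<M , _) N N≤ = M * exp (- (b * log x)) , *-pos 0<M (exp-pos _) , 0# , λ B _ → begin
      fromℕ (N B)                                      ≤⟨ N≤ B ⟩
      M * exp (b * (log (log B) - log x))              ≈⟨ *-congˡ (exp-shift b B x) ⟩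
      M * (exp (- (b * log x)) * log B ^ʳ b)           ≈⟨ *-assoc _ _ _ ⟨
      M * exp (- (b * log x)) * log B ^ʳ b             ∎

    module _ {b} (0≤b : 0# ≤ b) (bounded : BoundedCharge b) (B : ℝ) where

      enumerate-orbit : ∃[ Qs ] (Enumerates (points V) (λ Q → Q ∈ Orbit S P × H Q ≤ B) Qs ×
                                 fromℕ (length Qs) ≤ proj₁ bounded * exp (b * (log (log B) - log x)))
      enumerate-orbit = named⇒enumerable (points V) em {λ v → to ⟪ v ⟫ P} (λ {u} {v} u≋v → ⟪⟫-cong {u} {v} u≋v P)
        (λ { {Q} {Q′} Q≈Q′ ((f , f∈M , Q≈fP) , HQ≤B) →
          (f , f∈M , Setoid.trans (points V) {Q′} {Q} {to f P} (Setoid.sym (points V) {Q} {Q′} Q≈Q′) Q≈fP) ,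
          ≤-trans (≤-reflexive (sym (H-cong {Q} {Q′} Q≈Q′))) HQ≤B })
        (λ { Q ((f , f∈M , Q≈fP) , HQ≤B) →
          let v , f≈v = generated⇒⟪⟫ {f} f∈M
              Q≈vP    = Setoid.trans (points V) {Q} {to f P} {to ⟪ v ⟫ P} Q≈fP (f≈v P)
          in v , Q≈vP , H≤⇒weight≤ v B (≤-trans (≤-reflexive (sym (H-cong {Q} {to ⟪ v ⟫ P} Q≈vP))) HQ≤B) })
        0≤b bounded

      enumerate-monoid : ∃[ fs ] (Enumerates (endos V) (λ f → f ∈ GeneratedMonoid S × H (to f P) ≤ B) fs ×
                                  fromℕ (length fs) ≤ proj₁ bounded * exp (b * (log (log B) - log x)))
      enumerate-monoid = named⇒enumerable (endos V) em {⟪_⟫} (λ {u} {v} → ⟪⟫-cong {u} {v})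
        (λ { {f} {g} f≈g ((θs , θs∈S , f≈) , H≤B) →
          (θs , θs∈S , Setoid.trans (endos V) {g} {f} {compose θs} (Setoid.sym (endos V) {f} {g} f≈g) f≈) ,
          ≤-trans (≤-reflexive (sym (H-cong {to f P} {to g P} (f≈g P)))) H≤B })
        (λ { f (f∈M , H≤B) → let v , f≈v = generated⇒⟪⟫ {f} f∈M in
          v , f≈v , H≤⇒weight≤ v B (≤-trans (≤-reflexive (sym (H-cong {to f P} {to ⟪ v ⟫ P} (f≈v P)))) H≤B) })
        0≤b bounded

    -- By freeness distinct words give distinct endomorphisms, so a large family of light words
    -- embeds into the enumeration.
    lower-≪ : IsFreeNonabelian S → ∀ {b} → Growing b →
              (enum : ∀ B → ∃[ fs ] Enumerates (endos V) (λ f → f ∈ GeneratedMonoid S × H (to f P) ≤ B) fs) →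
              (λ B → log B ^ʳ b) ≪ (λ B → fromℕ (length (proj₁ (enum B))))
    -- The threshold `exp y` ensures `log B ≥ y`, which makes the weight bound `T` nonnegative. The
    -- factor `exp (b * log y)` undoes the shift by `log y`.
    lower-≪ S-free {b} (c , 0<c , grow) enum = exp (b * log y) * c , *-pos (exp-pos _) 0<c , exp y , λ B expy≤B →
      let 0<B : 0# < B
          0<B = begin-strict 0# <⟨ exp-pos y ⟩ exp y ≤⟨ expy≤B ⟩ B ∎
          y≤logB : y ≤ log B
          y≤logB = ≤-log expy≤B
          0<logB : 0# < log B
          0<logB = begin-strict 0# <⟨ 0<y ⟩ y ≤⟨ y≤logB ⟩ log B ∎
          T = log (log B) - log y
          vs , vs! , vs≤T , ∣vs∣ = grow T (x≤y⇒0≤y-x (≤-log (≤-trans (≤-reflexive (exp-log 0<y)) y≤logB)))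
          fs , fs-enum = enum B
      in begin
      exp (b * log (log B))
        ≈⟨ exp-cong (solve 3 (λ b l k → b :* l := b :* k :+ b :* (l :- k)) refl b (log (log B)) (log y)) ⟩
      exp (b * log y + b * T)                             ≈⟨ exp-+ _ _ ⟩
      exp (b * log y) * exp (b * T)                       ≤⟨ *-monoʳ-≤ (<⇒≤ (exp-pos _)) ∣vs∣ ⟩
      exp (b * log y) * (c * fromℕ (length vs))           ≈⟨ *-assoc _ _ _ ⟨
      exp (b * log y) * c * fromℕ (length vs)
        ≡⟨ ≡.cong (λ k → exp (b * log y) * c * fromℕ k) (length-map ⟪_⟫ vs) ⟨
      exp (b * log y) * c * fromℕ (length (map ⟪_⟫ vs))
        ≤⟨ *-monoʳ-≤ (*-nonNeg (<⇒≤ (exp-pos _)) (<⇒≤ 0<c))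
             (length-⊆ (endos V) (Unique.map⁺ wordSetoid (endos V) {⟪_⟫} (λ {u} {v} → ⟪⟫-injective u v) vs!)
               (All.map⁺ (All.map (λ {v} v≤T → Equivalence.to (Enumerates.complete fs-enum ⟪ v ⟫)
                 (⟪⟫-generated v , weight≤⇒H≤ v B 0<B 0<logB v≤T)) vs≤T))) ⟩
      exp (b * log y) * c * fromℕ (length fs)             ∎
      where
      ⟪⟫-injective : ∀ u v → ⟪ u ⟫ ≈ₑ ⟪ v ⟫ → u ≋ v
      ⟪⟫-injective u v u≈v = Pointwise.map⁻ proj₁ proj₁ (IsFreeNonabelian.free S-free (map proj₁ u) (map proj₁ v)
        (All.map⁺ (All.universal proj₂ u)) (All.map⁺ (All.universal proj₂ v)) u≈v)

  -- The two counting statements.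

  orbit-count : ∃[ b ] (b > 0# × ∃[ B₀ ] (∀ P → H P > B₀ →
      Σ (ℝ → ℕ) λ N → ((∀ (B : ℝ) → HasCardinality (points V) (λ Q → Q ∈ Orbit S P × H Q ≤ B) (N B))
        × (λ B → fromℕ (N B)) ≪ (λ B → log B ^ʳ b))))
  -- The condition `H P > exp A` says `h P > A`, so the shifted height `h P - A` is positive and
  -- grows along every word.
  orbit-count = let b , 0<b , bounded = bounded-exponent in b , 0<b , exp A , λ P H>B₀ →
    let A<hP = exp-cancel-< H>B₀
        enum = enumerate-orbit P A<hP (<⇒≤ 0<b) bounded
    in (λ B → length (proj₁ (enum B))) , (λ B → proj₁ (enum B) , proj₁ (proj₂ (enum B)) , ≡.refl) ,
       upper-≪ P A<hP bounded (λ B → length (proj₁ (enum B))) (λ B → proj₂ (proj₂ (enum B)))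

  monoid-count : IsFreeNonabelian S →
      ∃[ B₀ ] (∀ ε → ε > 0# → ∃[ b ] (b > 0# × (∀ P → H P > B₀ →
        Σ (ℝ → ℕ) λ N → ((∀ (B : ℝ) → HasCardinality (endos V) (λ f → f ∈ GeneratedMonoid S × H (to f P) ≤ B) (N B))
          × (λ B → log B ^ʳ b) ≪ (λ B → fromℕ (N B))
          × (λ B → fromℕ (N B)) ≪ (λ B → log B ^ʳ (b + ε))))))
  -- `A` comes from the error bound and `τ` alone, so the threshold is fixed before `ε` is given.
  monoid-count S-free = exp A , λ ε 0<ε →
    let φ , ψ , φ∈S , ψ∈S , φ≉ψ = IsFreeNonabelian.twoElements S-free
        b , 0<b , growing , bounded = growth-exponent {φ , φ∈S} {ψ , ψ∈S} φ≉ψ 0<ε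
    in b , 0<b , λ P H>B₀ →
    let A<hP = exp-cancel-< H>B₀
        enum = enumerate-monoid P A<hP (+-nonNeg (<⇒≤ 0<b) (<⇒≤ 0<ε)) bounded
    in (λ B → length (proj₁ (enum B))) , (λ B → proj₁ (enum B) , proj₁ (proj₂ (enum B)) , ≡.refl) ,
       lower-≪ P A<hP S-free growing (λ B → proj₁ (enum B) , proj₁ (proj₂ (enum B))) ,
       upper-≪ P A<hP bounded (λ B → length (proj₁ (enum B))) (λ B → proj₂ (proj₂ (enum B)))

theorem1p2 :
  ExcludedMiddle (lsuc 0ℓ) →
  (R : RealNumbers) (K : Field) (gf : GlobalField K) (K̄ : AlgebraicClosure K) →
  let open RealNumbers R renaming (Carrier to ℝ)
      open Geometry K̄
      open Heights R gf K̄
  in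
  (V : ProjectiveSet K) → IsVariety V →
  (η : Picℝ V) (h : Point V → ℝ) → IsWeilHeight η h →
  (S : Pred (Endo V) 0ℓ) → S Respects _≈ₑ_ →
  UniformlyLogDiscrete η h S →
  let H : Point V → ℝ
      H P = exp (h P)
  in
  (∃[ b ] (b > 0# × ∃[ B₀ ] (∀ P → H P > B₀ →
    Σ (ℝ → ℕ) λ N → ((∀ (B : ℝ) → HasCardinality (points V) (λ Q → Q ∈ Orbit S P × H Q ≤ B) (N B))
      × (λ B → fromℕ (N B)) ≪ (λ B → log B ^ʳ b)))))
  ×
  (IsFreeNonabelian S →
    ∃[ B₀ ] (∀ ε → ε > 0# → ∃[ b ] (b > 0# × (∀ P → H P > B₀ →
      Σ (ℝ → ℕ) λ N → ((∀ (B : ℝ) → HasCardinality (endos V) (λ f → f ∈ GeneratedMonoid S × H (to f P) ≤ B) (N B))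
        × (λ B → log B ^ʳ b) ≪ (λ B → fromℕ (N B))
        × (λ B → fromℕ (N B)) ≪ (λ B → log B ^ʳ (b + ε)))))))
theorem1p2 em R K gf K̄ V _ η h weil S _ S-uld = orbit-count , monoid-count
  where open OrbitCounting em R gf K̄ V η h (Heights.IsWeilHeight.h-cong weil) S S-uld
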